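{- Let $l\ge1$, and let $a,b\ge1$, $j\ge0$ and $n$ be integers with $a+b+1=l(n-j)$. Then $$\sum_{i\geq0}h_{i}\,Q_{n-i,a,j}=\sum_{i\geq0}h_i\,Q_{n-i,b,j},$$ where $h_i$ is the complete homogeneous symmetric function of degree $i$ in $x_1,x_2,\dots$ ($h_0=1$) and $Q_{m,k,j}$ is the flag Eulerian quasisymmetric function described in the context (with $Q_{m,k,j}=0$ for $m<0$).
   Context: Fix a positive integer $l$. Let $\mathcal{B}$ be the totally ordered alphabet $1^0<1^1<\cdots<1^{l-1}<\overline{1^0}<2^0<2^1<\cdots<2^{l-1}<\overline{2^0}<3^0<\cdots$. For $u\ge1$, $0\le m\le l-1$, the letter $u^m$ is called $m$-colored (unbarred), and $\overline{u^0}$ is called $0$-colored and barred. The absolute value of $u^m$ and of $\overline{u^0}$ is $u$, and the weight of either letter is $x_u$ (commuting indeterminates $x_1,x_2,\dots$). A circular word $(w)$ is $w$ written clockwise around a circle (up to rotation); it is primitive if $w$ is not $w'w'\cdots w'$ ($\ge2$ copies) for some word $w'$. A colored necklace is a primitive circular word over $\mathcal{B}$ such that (1) every barred letter is followed (clockwise) by a letter of lesser or equal absolute value, (2) every $0$-colored unbarred letter is followed by a letter of greater or equal absolute value, (3) a necklace of length one is not a single barred letter. A colored ornament is a finite multiset of colored necklaces; its length is its total number of letters, its weight $\mathrm{wt}(R)$ is the product of the weights of its letters, and $\mathrm{col}_m(R)$ ($1\le m\le l-1$) is its number of $m$-colored letters. The flag Eulerian quasisymmetric function is (via Hyatt's colored-ornament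 interpretation, taken here as the definition) $Q_{n,k,j}=\sum_R\mathrm{wt}(R)$, summed over colored ornaments $R$ of length $n$ with $l\cdot(\#\text{barred letters of }R)+\sum_{m=1}^{l-1}m\,\mathrm{col}_m(R)=k$ and exactly $j$ necklaces of length one consisting of a $0$-colored letter. In particular $Q_{0,0,0}=1$. -}

module Defs where

open import Data.Bool using (Bool; true; false; _∧_; _∨_; not; T)
open import Data.Nat using (ℕ; zero; suc; _+_; _*_; _<ᵇ_; _≤ᵇ_; _≡ᵇ_)
open import Data.Fin using (Fin; toℕ)
import Data.Fin as F
open import Data.List using (List; zip; []; _∷_; _++_; map; length; concat; replicate; take; drop; upTo)
open import Data.Bool.ListAction using (all; any)
open import Data.Nat.ListAction using (sum)
import Data.List.Properties as LP
open import Data.Nat.Properties using (_≟_)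
open import Data.Integer as Z using (ℤ; +_)
open import Data.Product using (Σ; _×_; _,_)
open import Relation.Nullary.Decidable using (⌊_⌋)

-- Letters of the colored alphabet B.  The index u : ℕ is 0-based:
-- `col u m` is the letter (u+1)^m and `bar u` is the barred letter
-- overline{(u+1)^0}; both have weight x_{u+1}.
data Letter (l : ℕ) : Set where
  col : ℕ → Fin l → Letter l
  bar : ℕ → Letter l

absL : ∀ {l} → Letter l → ℕ
absL (col u _) = u
absL (bar u)   = u

-- position in the total order 1^0<...<1^{l-1}<bar 1^0<2^0<... (injective)
rank : ∀ {l} → Letter l → ℕ
rank {l} (col u m) = u * suc l + toℕ m
rank {l} (bar u)   = u * suc l + l

ranks : ∀ {l} → List (Letter l) → List ℕ
ranks = map rank

eqW : ∀ {l} → List (Letter l) → List (Letter l) → Bool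
eqW v w = ⌊ LP.≡-dec _≟_ (ranks v) (ranks w) ⌋

lexLeq : List ℕ → List ℕ → Bool
lexLeq []       _        = true
lexLeq (_ ∷ _)  []       = false
lexLeq (x ∷ xs) (y ∷ ys) = (x <ᵇ y) ∨ ((x ≡ᵇ y) ∧ lexLeq xs ys)

isPower : ∀ {l} → List (Letter l) → Bool
isPower w = any (λ d → any (λ k → (2 ≤ᵇ k) ∧ eqW w (concat (replicate k (take d w))))
                          (upTo (suc (length w))))
                (upTo (suc (length w)))

nonEmpty : ∀ {A : Set} → List A → Bool
nonEmpty []      = false
nonEmpty (_ ∷ _) = true

isPrimitive : ∀ {l} → List (Letter l) → Bool
isPrimitive w = nonEmpty w ∧ not (isPower w)

rotate : ∀ {A : Set} → ℕ → List A → List A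
rotate k w = drop k w ++ take k w

-- w is the lexicographically least of its rotations (canonical
-- representative of the circular word (w))
isCanonicalRep : ∀ {l} → List (Letter l) → Bool
isCanonicalRep w = all (λ k → lexLeq (ranks w) (ranks (rotate k w))) (upTo (length w))

succPairs : ∀ {A : Set} → List A → List (A × A)
succPairs w = zip w (rotate 1 w)

okPair : ∀ {l} → Letter l × Letter l → Bool
okPair (bar u , y)         = absL y ≤ᵇ u
okPair (col u F.zero , y)  = u ≤ᵇ absL y
okPair (col u (F.suc _) , y) = true

singleBar : ∀ {l} → List (Letter l) → Bool
singleBar (bar _ ∷ []) = true
singleBar _            = false

-- a colored necklace, represented by its canonical (least) rotation
isNecklace : ∀ {l} → List (Letter l) → Bool
isNecklace w = isPrimitive w ∧ isCanonicalRep w ∧ all okPair (succPairs w) ∧ not (singleBar w)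

-- sorted (weakly increasing) lists: canonical form of finite multisets
sortedBy : ∀ {A : Set} → (A → A → Bool) → List A → Bool
sortedBy r []           = true
sortedBy r (x ∷ [])     = true
sortedBy r (x ∷ y ∷ xs) = r x y ∧ sortedBy r (y ∷ xs)

-- a colored ornament: a multiset of colored necklaces (sorted list of reps)
isOrnament : ∀ {l} → List (List (Letter l)) → Bool
isOrnament R = all isNecklace R ∧ sortedBy (λ v w → lexLeq (ranks v) (ranks w)) R

costL : ∀ {l} → Letter l → ℕ
costL {l} (bar _)   = l
costL     (col _ m) = toℕ m

cost : ∀ {l} → List (List (Letter l)) → ℕ
cost R = sum (map costL (concat R))

zeroColored : ∀ {l} → Letter l → Bool
zeroColored (bar _)          = true
zeroColored (col _ F.zero)   = true
zeroColored (col _ (F.suc _)) = false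

countB : ∀ {A : Set} → (A → Bool) → List A → ℕ
countB p []       = 0
countB p (x ∷ xs) = (if p x then 1 else 0) + countB p xs
  where open import Data.Bool using (if_then_else_)

fixedCount : ∀ {l} → List (List (Letter l)) → ℕ
fixedCount = countB (λ w → (length w ≡ᵇ 1) ∧ all zeroColored w)

-- the monomial x^α (α = list of exponents of x_1, x_2, ..., x_{length α})
-- equals the product of x_{u+1} over the (0-based) indices u in xs
hasWeight : List ℕ → List ℕ → Bool
hasWeight α xs = all (λ u → u <ᵇ length α) xs
               ∧ ⌊ LP.≡-dec _≟_ (map (λ u → countB (λ v → v ≡ᵇ u) xs) (upTo (length α))) α ⌋

-- The coefficient of x^α in  Σ_{i≥0} h_i Q_{n-i,k,j}  is the number of pairs
-- (M , R) with M a multiset of variables (weakly increasing list of 0-based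
-- indices; contributes to h_{|M|}), R a colored ornament with
-- |M| + length R = n, cost R = k, fixedCount R = j, and wt(M)wt(R) = x^α.
hQcond : (l : ℕ) (n : ℤ) (k j : ℕ) (α : List ℕ) → List ℕ → List (List (Letter l)) → Bool
hQcond l n k j α M R =
  sortedBy _≤ᵇ_ M ∧ isOrnament R
  ∧ ⌊ (+ (length M + length (concat R))) Z.≟ n ⌋
  ∧ (cost R ≡ᵇ k) ∧ (fixedCount R ≡ᵇ j)
  ∧ hasWeight α (M ++ map absL (concat R))

HQcoeffSet : (l : ℕ) (n : ℤ) (k j : ℕ) (α : List ℕ) → Set
HQcoeffSet l n k j α = Σ (List ℕ) λ M → Σ (List (List (Letter l))) λ R → T (hQcond l n k j α M R)

{-# OPTIONS --safe #-}

-- Adding h_i to Q amounts to letting the i extra variables be additional one-letter necklaces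
-- u⁰, while the j original fixed necklaces are set aside.  The Lyndon factorization (for the
-- reversed order of letters) then turns ornaments into banners: words in which every adjacent
-- pair satisfies the necklace conditions and whose last letter is unbarred.  On banners of
-- length N, reversing the absolute values and replacing the colors c₁, …, c_N (barred letters
-- having color l) by l - c_{N-1}, …, l - c₁, l - 1 - c_N is an involution sending cost c to
-- l N - 1 - c.
module Submission where

open import Defs
open import Data.Bool using (Bool; true; false; _∧_; _∨_; not; T; T?)
open import Data.Bool.ListAction using (all)
import Data.Bool.Properties as B
open import Data.Empty using (⊥; ⊥-elim)
open import Data.Fin as Fin using (Fin; toℕ; fromℕ<)
import Data.Fin.Properties as Fin
open import Data.Integer as ℤ using (ℤ)
import Data.Integer.Properties as ℤ
open import Data.List using (List; []; _∷_; _++_; _∷ʳ_; _∷ʳ′_; [_]; concat; drop; filter; initLast; length; map; replicate; take; upTo; zip)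
import Data.List.Properties as L
open import Data.List.Membership.Propositional using (lose)
open import Data.List.Membership.Propositional.Properties using (∈-upTo⁺)
open import Data.List.Relation.Binary.Permutation.Propositional as ↭ using (_↭_; ↭-refl; ↭-reflexive; ↭-sym; ↭-trans; ↭⇒↭ₛ; module PermutationReasoning)
import Data.List.Relation.Binary.Permutation.Homogeneous as Homogeneous
import Data.List.Relation.Binary.Permutation.Propositional.Properties as Perm
open import Data.List.Relation.Binary.Pointwise using (Pointwise-≡⇒≡)
open import Data.List.Relation.Unary.All as All using (All; []; _∷_)
import Data.List.Relation.Unary.All.Properties as All
open import Data.List.Relation.Unary.AllPairs using (_∷_)
open import Data.List.Relation.Unary.Any using (satisfied)
import Data.List.Relation.Unary.Any.Properties as Any
open import Data.List.Relation.Unary.Linked as Linked using (Linked; []; [-]; _∷_)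
open import Data.List.Relation.Unary.Linked.Properties using (Linked⇒AllPairs)
import Data.List.Relation.Unary.Sorted.TotalOrder.Properties as Sorted
import Data.List.Sort as Sort
open import Data.Nat using (ℕ; zero; suc; _+_; _∸_; _≤_; _<_; _<?_; _≡ᵇ_; _<ᵇ_; _≤ᵇ_; z≤n; s≤s)
open import Data.Nat.ListAction using (sum)
open import Data.Nat.ListAction.Properties using (sum-++; sum-↭)
import Data.Nat.Properties as ℕ
open import Data.Nat.Solver using (module +-*-Solver)
open import Data.Product using (∃; ∃₂; _×_; _,_; proj₁; proj₂)
open import Data.Sum using (_⊎_; inj₁; inj₂)
open import Data.Unit using (⊤; tt)
open import Function using (_∘_)
open import Function.Bundles using (Equivalence; _↔_; mk↔ₛ′)
open import Level using (0ℓ)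
open import Relation.Binary using (DecTotalOrder; IsDecTotalOrder; IsStrictTotalOrder; Trichotomous; tri<; tri≈; tri>)
import Relation.Binary.Construct.Flip.EqAndOrd as Flip
import Relation.Binary.Construct.StrictToNonStrict as StrictToNonStrict
open import Relation.Binary.PropositionalEquality hiding ([_])
open import Relation.Nullary using (¬_; yes; no)
open import Relation.Nullary.Decidable using (fromWitness; toWitness; ⌊_⌋)
open import Relation.Unary using (Decidable; ∁)
open import Relation.Unary.Properties using (∁?)

-- Once the fixed necklaces of `R` are dropped, the necklaces coming from `M` are the only fixed
-- ones, so nothing is lost: pairs (M, R) correspond to a multiset of j variables together with an
-- arbitrary ornament of length N = n - j. Letters of color 0 cost nothing, so the cost is kept, and
-- a symmetry of all ornaments of length N remains to be found. Reading a bar as color l turns the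
-- two necklace conditions into mirror images: passing from color c to l - c exchanges "followed by
-- a smaller or equal value" with "followed by a greater or equal value", and reading the values
-- backwards exchanges them again. A linear word has only N - 1 letters with a successor, whose
-- colors range over 0..l; the last color ranges over 0..l - 1 and is complemented to l - 1. Hence
-- the total l(N - 1) + (l - 1), which is the origin of the 1 in a + b + 1. Multisets are sorted
-- lists of canonical words, so the maps are compared up to permutation and become equal only after
-- sorting.

-- Rotations and powers of words

module _ {A : Set} where

  infix 4 _⟳_
  -- Generated by moving one letter from front to back, so that invariance under rotation has to be
  -- checked for a single letter only. Symmetry is not built in; it comes from `⟳-split`.
  data _⟳_ : List A → List A → Set where
    done : ∀ {w} → w ⟳ w
    step : ∀ {x xs w} → xs ∷ʳ x ⟳ w → x ∷ xs ⟳ w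

  ⟳-reflexive : ∀ {v w} → v ≡ w → v ⟳ w
  ⟳-reflexive refl = done

  ⟳-trans : ∀ {u v w} → u ⟳ v → v ⟳ w → u ⟳ w
  ⟳-trans done     q = q
  ⟳-trans (step p) q = step (⟳-trans p q)

  ++-⟳ : ∀ u v → u ++ v ⟳ v ++ u
  ++-⟳ []      v = ⟳-reflexive (sym (L.++-identityʳ v))
  ++-⟳ (x ∷ u) v = step (subst₂ _⟳_ (sym (L.++-assoc u v [ x ])) (L.++-assoc v [ x ] u) (++-⟳ u (v ∷ʳ x)))

  -- A chain of steps may run round the circle several times, yet it collapses to one cut. The
  -- letter `x` just moved is the last one of `v` and joins the front part; if `v` is empty, a full
  -- turn is complete and the cut starts anew after `x`.
  ⟳-split : ∀ {w w′} → w ⟳ w′ → ∃₂ λ u v → w ≡ u ++ v × w′ ≡ v ++ u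
  ⟳-split {w} done = w , [] , sym (L.++-identityʳ w) , refl
  ⟳-split (step {x} {xs} p) with ⟳-split p
  ... | u , v , eq , refl with initLast v
  ... | [] = [ x ] , xs , refl , sym (trans eq (L.++-identityʳ u))
  ... | v₀ ∷ʳ′ z with L.∷ʳ-injective xs (u ++ v₀) (trans eq (sym (L.++-assoc u v₀ [ z ])))
  ... | refl , refl = x ∷ u , v₀ , refl , L.++-assoc v₀ [ x ] u

  ⟳-sym : ∀ {v w} → v ⟳ w → w ⟳ v
  ⟳-sym p with ⟳-split p
  ... | u , v , refl , refl = ++-⟳ v u

  ⟳⇒↭ : ∀ {v w} → v ⟳ w → v ↭ w
  ⟳⇒↭ done               = ↭-refl
  ⟳⇒↭ (step {x} {xs} p) = ↭-trans (Perm.∷↭∷ʳ x xs) (⟳⇒↭ p)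

  -- Levi's lemma. The overlap in the second alternative is nonempty, so equal prefixes fall under
  -- the first.
  ++-split : ∀ (u : List A) {v} u′ {v′} → u ++ v ≡ u′ ++ v′ →
             (∃ λ r → u′ ≡ u ++ r × v ≡ r ++ v′) ⊎ (∃₂ λ z r → u ≡ u′ ++ z ∷ r × v′ ≡ z ∷ r ++ v)
  ++-split []      u′       eq = inj₁ (u′ , refl , eq)
  ++-split (x ∷ u) []       eq = inj₂ (x , u , refl , sym eq)
  ++-split (x ∷ u) (y ∷ u′) eq with L.∷-injective eq
  ... | refl , eq′ with ++-split u u′ eq′
  ... | inj₁ (r , refl , refl)     = inj₁ (r , refl , refl)
  ... | inj₂ (z , r , refl , refl) = inj₂ (z , r , refl , refl)

  ≢-proper : ∀ {x : A} p {w} s → w ≢ x ∷ (p ++ w) ++ s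
  ≢-proper {x} p {w} s eq = ℕ.m≢1+m+n (length w) (begin
    length w                           ≡⟨ cong length eq ⟩
    suc (length ((p ++ w) ++ s))       ≡⟨ cong suc (Perm.↭-length (↭-trans (↭-reflexive (L.++-assoc p w s)) (Perm.shifts p w))) ⟩
    suc (length (w ++ p ++ s))         ≡⟨ cong suc (L.length-++ w) ⟩
    suc (length w + length (p ++ s)) ∎)
    where open ≡-Reasoning

  Power : List A → Set
  Power w = ∃₂ λ z k → w ≡ concat (replicate (2 + k) z)

  concat-replicate-rotate : ∀ (x : A) z k → concat (replicate k (x ∷ z)) ∷ʳ x ≡ x ∷ concat (replicate k (z ∷ʳ x))
  concat-replicate-rotate x z zero    = refl
  concat-replicate-rotate x z (suc k) = cong (x ∷_) (begin
    (z ++ concat (replicate k (x ∷ z))) ∷ʳ x ≡⟨ L.++-assoc z _ _ ⟩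
    z ++ concat (replicate k (x ∷ z)) ∷ʳ x   ≡⟨ cong (z ++_) (concat-replicate-rotate x z k) ⟩
    z ++ x ∷ concat (replicate k (z ∷ʳ x))   ≡⟨ L.++-assoc z _ _ ⟨
    (z ∷ʳ x) ++ concat (replicate k (z ∷ʳ x)) ∎)
    where open ≡-Reasoning

  concat-replicate-[] : ∀ k → concat (replicate k []) ≡ [] {A = A}
  concat-replicate-[] zero    = refl
  concat-replicate-[] (suc k) = concat-replicate-[] k

  Power-⟳ : ∀ {v w} → v ⟳ w → Power v → Power w
  Power-⟳ done pw = pw
  Power-⟳ (step p) ([] , k , eq) with trans eq (concat-replicate-[] k)
  ... | ()
  Power-⟳ (step p) (x ∷ z , k , refl) = Power-⟳ p (z ∷ʳ x , k , (begin
    (z ++ concat (replicate (suc k) (x ∷ z))) ∷ʳ x ≡⟨ L.++-assoc z _ _ ⟩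
    z ++ concat (replicate (suc k) (x ∷ z)) ∷ʳ x   ≡⟨ cong (z ++_) (concat-replicate-rotate x z (suc k)) ⟩
    z ++ x ∷ concat (replicate (suc k) (z ∷ʳ x))   ≡⟨ L.++-assoc z _ _ ⟨
    (z ∷ʳ x) ++ concat (replicate (suc k) (z ∷ʳ x)) ∎))
    where open ≡-Reasoning

-- Lyndon words

module Lex {A : Set} {_<_ : A → A → Set} (sto : IsStrictTotalOrder _≡_ _<_) where

  open IsStrictTotalOrder sto using (compare; irrefl) renaming (trans to <-trans)

  infix 4 _≺_ _⋖_ _≽_
  data _≺_ : List A → List A → Set where
    halt : ∀ {y ys} → [] ≺ y ∷ ys
    this : ∀ {x y xs ys} → x < y → x ∷ xs ≺ y ∷ ys
    next : ∀ {x xs ys} → xs ≺ ys → x ∷ xs ≺ x ∷ ys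

  -- The comparisons decided by a differing letter. Unlike `_≺_`, which also holds for proper
  -- prefixes, they survive appending anything on either side.
  data _⋖_ : List A → List A → Set where
    this : ∀ {x y xs ys} → x < y → x ∷ xs ⋖ y ∷ ys
    next : ∀ {x xs ys} → xs ⋖ ys → x ∷ xs ⋖ x ∷ ys

  ≺-irrefl : ∀ {xs} → ¬ xs ≺ xs
  ≺-irrefl (this p) = irrefl refl p
  ≺-irrefl (next p) = ≺-irrefl p

  ≺-trans : ∀ {xs ys zs} → xs ≺ ys → ys ≺ zs → xs ≺ zs
  ≺-trans halt     (this q) = halt
  ≺-trans halt     (next q) = halt
  ≺-trans (this p) (this q) = this (<-trans p q)
  ≺-trans (this p) (next q) = this p
  ≺-trans (next p) (this q) = this q
  ≺-trans (next p) (next q) = next (≺-trans p q)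

  ≺-asym : ∀ {xs ys} → xs ≺ ys → ¬ ys ≺ xs
  ≺-asym p q = ≺-irrefl (≺-trans p q)

  ≺⇒≢ : ∀ {xs ys} → xs ≺ ys → xs ≢ ys
  ≺⇒≢ p refl = ≺-irrefl p

  ≺-compare : Trichotomous _≡_ _≺_
  ≺-compare []       []       = tri≈ (λ ()) refl (λ ())
  ≺-compare []       (y ∷ ys) = tri< halt (λ ()) (λ ())
  ≺-compare (x ∷ xs) []       = tri> (λ ()) (λ ()) halt
  ≺-compare (x ∷ xs) (y ∷ ys) with compare x y
  ... | tri< p _ _ = tri< (this p) (≺⇒≢ (this p)) (≺-asym (this p))
  ... | tri> _ _ p = tri> (≺-asym (this p)) (λ eq → ≺⇒≢ (this p) (sym eq)) (this p)
  ... | tri≈ _ refl _ with ≺-compare xs ys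
  ... | tri< p _ _ = tri< (next p) (≺⇒≢ (next p)) (≺-asym (next p))
  ... | tri> _ _ p = tri> (≺-asym (next p)) (λ eq → ≺⇒≢ (next p) (sym eq)) (next p)
  ... | tri≈ _ refl _ = tri≈ ≺-irrefl refl ≺-irrefl

  ≺-isStrictTotalOrder : IsStrictTotalOrder _≡_ _≺_
  ≺-isStrictTotalOrder = record
    { isStrictPartialOrder = record
      { isEquivalence = isEquivalence
      ; irrefl        = λ { refl → ≺-irrefl }
      ; trans         = ≺-trans
      ; <-resp-≈      = resp₂ _≺_
      }
    ; compare = ≺-compare
    }

  ⋖⇒≺ : ∀ {v w} → v ⋖ w → v ≺ w
  ⋖⇒≺ (this p) = this p
  ⋖⇒≺ (next p) = next (⋖⇒≺ p)

  ⋖-++ : ∀ {v w} s t → v ⋖ w → v ++ s ⋖ w ++ t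
  ⋖-++ s t (this p) = this p
  ⋖-++ s t (next p) = next (⋖-++ s t p)

  ≺-cases : ∀ {v w} → v ≺ w → v ⋖ w ⊎ ∃₂ λ z r → w ≡ v ++ z ∷ r
  ≺-cases halt     = inj₂ (_ , _ , refl)
  ≺-cases (this p) = inj₁ (this p)
  ≺-cases (next p) with ≺-cases p
  ... | inj₁ q              = inj₁ (next q)
  ... | inj₂ (z , r , refl) = inj₂ (z , r , refl)

  ≺-++⁺ˡ : ∀ u {v w} → v ≺ w → u ++ v ≺ u ++ w
  ≺-++⁺ˡ []      p = p
  ≺-++⁺ˡ (x ∷ u) p = next (≺-++⁺ˡ u p)

  prefix-≺ : ∀ u {z r} → u ≺ u ++ z ∷ r
  prefix-≺ []      = halt
  prefix-≺ (x ∷ u) = next (prefix-≺ u)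

  _≽_ : List A → List A → Set
  v ≽ w = w ≺ v ⊎ v ≡ w

  ≽-trans : ∀ {u v w} → u ≽ v → v ≽ w → u ≽ w
  ≽-trans (inj₁ p)    (inj₁ q)    = inj₁ (≺-trans q p)
  ≽-trans (inj₁ p)    (inj₂ refl) = inj₁ p
  ≽-trans (inj₂ refl) q           = q

  ≽⇒⊀ : ∀ {v w} → v ≽ w → ¬ v ≺ w
  ≽⇒⊀ (inj₁ p)    q = ≺-asym p q
  ≽⇒⊀ (inj₂ refl) q = ≺-irrefl q

  ++-≽ : ∀ u v → u ++ v ≽ u
  ++-≽ u []      = inj₂ (L.++-identityʳ u)
  ++-≽ u (z ∷ r) = inj₁ (prefix-≺ u)

  -- The characterization by proper nonempty suffixes; it implies primitivity, and the empty word is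
  -- excluded by hand.
  Lyndon : List A → Set
  Lyndon []       = ⊥
  Lyndon (x ∷ xs) = ∀ u y v → xs ≡ u ++ y ∷ v → x ∷ xs ≺ y ∷ v

  Lyndon-[_] : ∀ x → Lyndon [ x ]
  Lyndon-[ x ] []      y v ()
  Lyndon-[ x ] (_ ∷ u) y v ()

  Lyndon-suffix : ∀ {w} z u y v → Lyndon w → w ≡ (z ∷ u) ++ y ∷ v → w ≺ y ∷ v
  Lyndon-suffix z u y v lw refl = lw u y v refl

  -- A suffix starting inside `u` exceeds `u` at a differing letter, because it is too short to
  -- extend `u`, and the comparison survives appending. A suffix starting in `v` is at least `v`, so
  -- uv ≺ v suffices.
  Lyndon-++ : ∀ {u v} → Lyndon u → Lyndon v → u ≺ v → Lyndon (u ++ v)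
  Lyndon-++ {x ∷ xs} {z ∷ zs} lu lv u≺v p y q eq with ++-split xs p eq
  ... | inj₂ (y′ , q′ , refl , eq′) with L.∷-injective eq′
  ... | refl , refl with ≺-cases (lu p y q′ refl)
  ... | inj₁ d            = ⋖⇒≺ (⋖-++ _ _ d)
  ... | inj₂ (z′ , r , eq″) = ⊥-elim (≢-proper {x = x} p {y ∷ q′} (z′ ∷ r) eq″)
  Lyndon-++ {x ∷ xs} {z ∷ zs} lu lv u≺v p y q eq | inj₁ (r , refl , eq′) = whole r eq′
    where
    uv≺v : x ∷ xs ++ z ∷ zs ≺ z ∷ zs
    uv≺v with ≺-cases u≺v
    ... | inj₁ d = subst (x ∷ xs ++ z ∷ zs ≺_) (L.++-identityʳ (z ∷ zs)) (⋖⇒≺ (⋖-++ (z ∷ zs) [] d))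
    -- Here v = ut with `t` nonempty: cancelling `u` leaves v ≺ t, which holds as `v` is Lyndon.
    ... | inj₂ (z′ , t , eq″) =
      subst (x ∷ xs ++ z ∷ zs ≺_) (sym eq″) (≺-++⁺ˡ (x ∷ xs) (Lyndon-suffix x xs z′ t lv eq″))
    whole : ∀ r → z ∷ zs ≡ r ++ y ∷ q → x ∷ xs ++ z ∷ zs ≺ y ∷ q
    whole []       refl = uv≺v
    whole (_ ∷ r) eq″  = ≺-trans uv≺v (Lyndon-suffix _ r y q lv eq″)

  -- Prepends a Lyndon word to a weakly decreasing factorization, absorbing the next factor as long
  -- as that one is larger. Merged words stay Lyndon by `Lyndon-++`, and stopping restores the
  -- decrease.
  push : List A → List (List A) → List (List A)
  push u []       = [ u ]
  push u (v ∷ vs) with ≺-compare u v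
  ... | tri< _ _ _ = push (u ++ v) vs
  ... | tri≈ _ _ _ = u ∷ v ∷ vs
  ... | tri> _ _ _ = u ∷ v ∷ vs

  concat-push : ∀ u vs → concat (push u vs) ≡ u ++ concat vs
  concat-push u []       = refl
  concat-push u (v ∷ vs) with ≺-compare u v
  ... | tri< _ _ _ = trans (concat-push (u ++ v) vs) (L.++-assoc u v (concat vs))
  ... | tri≈ _ _ _ = refl
  ... | tri> _ _ _ = refl

  push-Lyndon : ∀ {u vs} → Lyndon u → All Lyndon vs → All Lyndon (push u vs)
  push-Lyndon lu [] = lu ∷ []
  push-Lyndon {u} {v ∷ vs} lu (lv ∷ lvs) with ≺-compare u v
  ... | tri< u≺v _ _ = push-Lyndon (Lyndon-++ lu lv u≺v) lvs
  ... | tri≈ _ _ _   = lu ∷ lv ∷ lvs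
  ... | tri> _ _ _   = lu ∷ lv ∷ lvs

  push-≽ : ∀ {u vs} → Linked _≽_ vs → Linked _≽_ (push u vs)
  push-≽ {u} {[]} s = [-]
  push-≽ {u} {v ∷ vs} s with ≺-compare u v
  ... | tri< _ _ _   = push-≽ (Linked.tail s)
  ... | tri≈ _ u≡v _ = inj₂ u≡v ∷ s
  ... | tri> _ _ v≺u = inj₁ v≺u ∷ s

  factor : List A → List (List A)
  factor []      = []
  factor (x ∷ w) = push [ x ] (factor w)

  concat-factor : ∀ w → concat (factor w) ≡ w
  concat-factor []      = refl
  concat-factor (x ∷ w) = trans (concat-push [ x ] (factor w)) (cong (x ∷_) (concat-factor w))

  factor-Lyndon : ∀ w → All Lyndon (factor w)
  factor-Lyndon []      = []
  factor-Lyndon (x ∷ w) = push-Lyndon Lyndon-[ x ] (factor-Lyndon w)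

  factor-≽ : ∀ w → Linked _≽_ (factor w)
  factor-≽ []      = []
  factor-≽ (x ∷ w) = push-≽ (factor-≽ w)

  -- The prefix ends inside or at the end of some factor; the part of it lying in that factor is a
  -- prefix of the factor, hence at most the factor and so at most `L`.
  prefix-cut : ∀ {L} vs {z q t} → All (L ≽_) vs → concat vs ≡ z ∷ q ++ t →
               ∃₂ λ r y → ∃ λ s → z ∷ q ≡ r ++ y ∷ s × L ≽ y ∷ s
  prefix-cut [] _ ()
  prefix-cut (v ∷ vs) {z} {q} {t} (L≽v ∷ L≽vs) eq with ++-split v (z ∷ q) eq
  ... | inj₂ (y , r , refl , _) = [] , z , q , refl , ≽-trans L≽v (++-≽ (z ∷ q) (y ∷ r))
  ... | inj₁ ([] , eq′ , _) = [] , z , q , refl , subst (_ ≽_) (sym (trans eq′ (L.++-identityʳ v))) L≽v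
  ... | inj₁ (y ∷ r , eq′ , eq″) with prefix-cut vs L≽vs eq″
  ... | r′ , y′ , s , eq‴ , p = v ++ r′ , y′ , s , trans eq′ (trans (cong (v ++_) eq‴) (sym (L.++-assoc v r′ _))) , p

  -- The first factor is the longest Lyndon prefix, which forces uniqueness: a longer one would
  -- exceed `L`, yet lie below its own suffix found by `prefix-cut`, which is at most `L`.
  no-longer-prefix : ∀ {L vs z q t} → Lyndon L → Linked _≽_ (L ∷ vs) → Lyndon (L ++ z ∷ q) → concat vs ≢ z ∷ q ++ t
  no-longer-prefix {L@(x ∷ xs)} {vs} {z} {q} lL s lp eq with Linked⇒AllPairs ≽-trans s
  ... | L≽vs ∷ _ with prefix-cut vs L≽vs eq
  ... | r , y , s′ , eq′ , L≽s =
    ≽⇒⊀ L≽s (≺-trans (prefix-≺ L)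
      (Lyndon-suffix x (xs ++ r) y s′ lp (trans (cong (L ++_) eq′) (sym (L.++-assoc L r (y ∷ s′))))))

  factor-unique : ∀ {us vs} → All Lyndon us → All Lyndon vs → Linked _≽_ us → Linked _≽_ vs →
                  concat us ≡ concat vs → us ≡ vs
  factor-unique [] [] _ _ _ = refl
  factor-unique {[]} {(_ ∷ _) ∷ _} [] (_ ∷ _) _ _ ()
  factor-unique {(_ ∷ _) ∷ _} {[]} (_ ∷ _) [] _ _ ()
  factor-unique {u ∷ us} {v ∷ vs} (lu ∷ lus) (lv ∷ lvs) su sv eq with ++-split u v eq
  ... | inj₂ (z , r , refl , eq′)     = ⊥-elim (no-longer-prefix lv sv lu eq′)
  ... | inj₁ (z ∷ r , refl , eq′)     = ⊥-elim (no-longer-prefix lu su lv eq′)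
  ... | inj₁ ([] , eq′ , eq″) =
    cong₂ _∷_ (sym (trans eq′ (L.++-identityʳ u)))
      (factor-unique lus lvs (Linked.tail su) (Linked.tail sv) eq″)

  factor-concat : ∀ {vs} → All Lyndon vs → Linked _≽_ vs → factor (concat vs) ≡ vs
  factor-concat {vs} ls s =
    factor-unique (factor-Lyndon (concat vs)) ls (factor-≽ (concat vs)) s (concat-factor (concat vs))

  -- `z` stands for the head of a circular list. If walking down from it meets no ascent, the last
  -- entry either equals `z`, and so do all the others, or lies below it, and the ascent is across
  -- the cut.
  ascent : ∀ {z} x xs → z ≽ x →
           All (_≡ z) (x ∷ xs)
         ⊎ (∃₂ λ ps qs → ∃₂ λ u v → x ∷ xs ≡ ps ++ u ∷ v ∷ qs × u ≺ v)
         ⊎ (∃₂ λ ys y → x ∷ xs ≡ ys ∷ʳ y × y ≺ z)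
  ascent x [] (inj₂ refl) = inj₁ (refl ∷ [])
  ascent x [] (inj₁ x≺z)  = inj₂ (inj₂ ([] , x , refl , x≺z))
  ascent x (y ∷ ys) z≽x with ≺-compare x y
  ... | tri< x≺y _ _ = inj₂ (inj₁ ([] , ys , x , y , refl , x≺y))
  ... | tri≈ _ refl _ with ascent y ys z≽x
  ... | inj₁ (refl ∷ all) = inj₁ (refl ∷ refl ∷ all)
  ... | inj₂ (inj₁ (ps , qs , u , v , eq , p)) = inj₂ (inj₁ (x ∷ ps , qs , u , v , cong (x ∷_) eq , p))
  ... | inj₂ (inj₂ (zs , z′ , eq , p)) = inj₂ (inj₂ (x ∷ zs , z′ , cong (x ∷_) eq , p))
  ascent x (y ∷ ys) z≽x | tri> _ _ y≺x with ascent y ys (≽-trans z≽x (inj₁ y≺x))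
  ... | inj₁ (refl ∷ all) = ⊥-elim (≽⇒⊀ z≽x y≺x)
  ... | inj₂ (inj₁ (ps , qs , u , v , eq , p)) = inj₂ (inj₁ (x ∷ ps , qs , u , v , cong (x ∷_) eq , p))
  ... | inj₂ (inj₂ (zs , z′ , eq , p)) = inj₂ (inj₂ (x ∷ zs , z′ , cong (x ∷_) eq , p))

  concat-constant : ∀ {z : List A} {xs} → All (_≡ z) xs → concat xs ≡ concat (replicate (length xs) z)
  concat-constant []           = refl
  concat-constant (refl ∷ all) = cong (_ ++_) (concat-constant all)

  -- Merging two circularly adjacent factors u ≺ v of a circular word shortens its list
  -- of Lyndon factors; when no such pair is left, all factors are equal.
  lyndon-rotation-concat : ∀ n {vs} → length vs ≡ suc n → All Lyndon vs →
                           ∃ λ w → concat vs ⟳ w × (Lyndon w ⊎ Power w)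
  lyndon-rotation-concat n {v ∷ vs} len ls with ascent v vs (inj₂ refl)
  lyndon-rotation-concat zero {v ∷ []} len (lv ∷ []) | inj₁ all = v , ⟳-reflexive (L.++-identityʳ v) , inj₁ lv
  lyndon-rotation-concat (suc n) {v ∷ v′ ∷ vs} len ls | inj₁ all =
    _ , done , inj₂ (v , length vs , concat-constant all)
  lyndon-rotation-concat n {v ∷ vs} len ls | inj₂ (inj₁ (ps , qs , u , u′ , eq , u≺u′)) =
    merge n (ℕ.suc-injective (trans (sym len) (trans (cong length eq)
      (trans (Perm.↭-length (Perm.shift u ps _)) (cong suc (Perm.↭-length (Perm.shift u′ ps qs)))))))
    where
    merge : ∀ n → n ≡ suc (length (ps ++ qs)) → ∃ λ w → concat (v ∷ vs) ⟳ w × (Lyndon w ⊎ Power w)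
    merge (suc n) len′ with subst (All {A = List A} Lyndon) eq ls
    ... | ls′ with All.++⁻ʳ ps ls′ | lyndon-rotation-concat n {ps ++ (u ++ u′) ∷ qs}
                    (trans (Perm.↭-length (Perm.shift (u ++ u′) ps qs)) (sym len′))
    ... | lu ∷ lu′ ∷ lqs | rec with rec (All.++⁺ (All.++⁻ˡ ps ls′) (Lyndon-++ lu lu′ u≺u′ ∷ lqs))
    ... | w , rot , l = w , subst (_⟳ w) concat≡ rot , l
      where
      concat≡ : concat (ps ++ (u ++ u′) ∷ qs) ≡ concat (v ∷ vs)
      concat≡ = begin
        concat (ps ++ (u ++ u′) ∷ qs)      ≡⟨ L.concat-++ ps _ ⟨
        concat ps ++ (u ++ u′) ++ concat qs ≡⟨ cong (concat ps ++_) (L.++-assoc u u′ _) ⟩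
        concat ps ++ concat (u ∷ u′ ∷ qs)  ≡⟨ L.concat-++ ps _ ⟩
        concat (ps ++ u ∷ u′ ∷ qs)         ≡⟨ cong concat eq ⟨
        concat (v ∷ vs) ∎
        where open ≡-Reasoning
  lyndon-rotation-concat n {v ∷ vs} len ls | inj₂ (inj₂ ([] , y , refl , y≺v)) = ⊥-elim (≺-irrefl y≺v)
  lyndon-rotation-concat n {v ∷ vs} len ls | inj₂ (inj₂ (_ ∷ ys , y , eq , y≺v)) with L.∷-injective eq
  ... | refl , refl = merge n (ℕ.suc-injective (trans (sym len) (cong suc (sym (Perm.↭-length (Perm.∷↭∷ʳ y ys)))))) ls
    where
    merge : ∀ n → n ≡ suc (length ys) → All Lyndon (v ∷ ys ∷ʳ y) → ∃ λ w → concat (v ∷ ys ∷ʳ y) ⟳ w × (Lyndon w ⊎ Power w)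
    merge (suc n) len′ (lv ∷ lys) with All.∷ʳ⁻ lys
    ... | lys′ , ly with lyndon-rotation-concat n {(y ++ v) ∷ ys} (sym len′) (Lyndon-++ ly lv y≺v ∷ lys′)
    ... | w , rot , l = w , ⟳-trans (subst₂ _⟳_ eq₁ eq₂ (++-⟳ (v ++ concat ys) y)) rot , l
      where
      open ≡-Reasoning
      eq₁ : (v ++ concat ys) ++ y ≡ concat (v ∷ ys ∷ʳ y)
      eq₁ = begin
        (v ++ concat ys) ++ y                ≡⟨ L.++-assoc v _ y ⟩
        v ++ concat ys ++ y                  ≡⟨ cong (λ t → v ++ concat ys ++ t) (L.++-identityʳ y) ⟨
        v ++ concat ys ++ concat [ y ]       ≡⟨ cong (v ++_) (L.concat-++ ys [ y ]) ⟩
        v ++ concat (ys ∷ʳ y) ∎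
      eq₂ : y ++ v ++ concat ys ≡ (y ++ v) ++ concat ys
      eq₂ = sym (L.++-assoc y v _)

  lyndon-rotation : ∀ x w → ∃ λ w′ → x ∷ w ⟳ w′ × (Lyndon w′ ⊎ Power w′)
  lyndon-rotation x w with factor (x ∷ w) | concat-factor (x ∷ w) | factor-Lyndon (x ∷ w)
  ... | []     | ()  | _
  ... | v ∷ vs | eq | ls with lyndon-rotation-concat _ refl ls
  ... | w′ , rot , l = w′ , subst (_⟳ w′) eq rot , l

  -- A nontrivial cut with uv and vu both Lyndon would give v ≺ vu ≺ u ≺ uv ≺ v.
  Lyndon-unique : ∀ {v w} → v ⟳ w → Lyndon v → Lyndon w → v ≡ w
  Lyndon-unique p lv lw with ⟳-split p
  ... | [] , v , refl , refl = sym (L.++-identityʳ v)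
  ... | x ∷ u , [] , refl , refl = L.++-identityʳ _
  ... | x ∷ u , y ∷ v , refl , refl =
    ⊥-elim (≺-asym (≺-trans (prefix-≺ (y ∷ v)) (Lyndon-suffix y v x u lw refl))
                   (≺-trans (prefix-≺ (x ∷ u)) (Lyndon-suffix x u y v lv refl)) )

  -- Removing the first copy of the root leaves a proper suffix that is also a prefix, so the power
  -- cannot be smaller than it.
  Lyndon⇒¬Power : ∀ {w} → Lyndon w → ¬ Power w
  Lyndon⇒¬Power lw ([] , k , eq) with trans eq (concat-replicate-[] k)
  Lyndon⇒¬Power () _ | refl
  Lyndon⇒¬Power lw (x ∷ z , k , refl) =
    ≽⇒⊀ (subst (_≽ concat (replicate (suc k) (x ∷ z))) (concat-replicate-comm k) (++-≽ _ (x ∷ z)))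
        (Lyndon-suffix x z x (z ++ concat (replicate k (x ∷ z))) lw refl)
    where
    concat-replicate-comm : ∀ k → concat (replicate (suc k) (x ∷ z)) ++ x ∷ z ≡ concat (replicate (2 + k) (x ∷ z))
    concat-replicate-comm zero    =
      trans (L.++-assoc (x ∷ z) [] (x ∷ z)) (cong ((x ∷ z) ++_) (sym (L.++-identityʳ (x ∷ z))))
    concat-replicate-comm (suc k) =
      trans (L.++-assoc (x ∷ z) (concat (replicate (suc k) (x ∷ z))) (x ∷ z)) (cong ((x ∷ z) ++_) (concat-replicate-comm k))

  -- Total on purpose: on powers the value is still a rotation, so letter counts are preserved
  -- unconditionally, while being Lyndon requires primitivity.
  lyndonRotation : List A → List A
  lyndonRotation []      = []
  lyndonRotation (x ∷ w) = proj₁ (lyndon-rotation x w)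

  ⟳-lyndonRotation : ∀ w → w ⟳ lyndonRotation w
  ⟳-lyndonRotation []      = done
  ⟳-lyndonRotation (x ∷ w) = proj₁ (proj₂ (lyndon-rotation x w))

  Lyndon-lyndonRotation : ∀ {w} → w ≢ [] → ¬ Power w → Lyndon (lyndonRotation w)
  Lyndon-lyndonRotation {[]}    ne _ = ⊥-elim (ne refl)
  Lyndon-lyndonRotation {x ∷ w} _ ¬p with lyndon-rotation x w
  ... | _ , _   , inj₁ l = l
  ... | _ , rot , inj₂ p = ⊥-elim (¬p (Power-⟳ (⟳-sym rot) p))

  Lyndon⇒≢[] : ∀ {w} → Lyndon w → w ≢ []
  Lyndon⇒≢[] () refl

  Lyndon-least : ∀ {v w} → Lyndon v → v ⟳ w → w ≽ v
  Lyndon-least ly p with ⟳-split p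
  ... | []    , v     , refl , refl = inj₂ (L.++-identityʳ v)
  ... | x ∷ u , []    , refl , refl = inj₂ (sym (L.++-identityʳ (x ∷ u)))
  ... | x ∷ u , y ∷ v , refl , refl = inj₁ (≺-trans (Lyndon-suffix x u y v ly refl) (prefix-≺ (y ∷ v)))

  ≽-antisym : ∀ {v w} → v ≽ w → w ≽ v → v ≡ w
  ≽-antisym (inj₂ eq) _ = eq
  ≽-antisym (inj₁ p) q  = ⊥-elim (≽⇒⊀ q p)

-- Boolean reflection, list permutations and sorting

T-∧⁻ : ∀ {x y} → T (x ∧ y) → T x × T y
T-∧⁻ = Equivalence.to B.T-∧

T-∧⁺ : ∀ {x y} → T x → T y → T (x ∧ y)
T-∧⁺ p q = Equivalence.from B.T-∧ (p , q)

T-∨⁻ : ∀ {x y} → T (x ∨ y) → T x ⊎ T y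
T-∨⁻ = Equivalence.to B.T-∨

T-∨⁺ : ∀ {x y} → T x ⊎ T y → T (x ∨ y)
T-∨⁺ = Equivalence.from B.T-∨

T-not⁺ : ∀ {x} → ¬ T x → T (not x)
T-not⁺ {true}  ¬p = ¬p tt
T-not⁺ {false} ¬p = tt

T-not⁻ : ∀ {x} → T (not x) → ¬ T x
T-not⁻ {false} _ ()

module _ {A : Set} where

  open import Data.Nat using (_*_)

  take-++ : ∀ (u v : List A) → take (length u) (u ++ v) ≡ u
  take-++ []      v = refl
  take-++ (x ∷ u) v = cong (x ∷_) (take-++ u v)

  drop-++ : ∀ (u v : List A) → drop (length u) (u ++ v) ≡ v
  drop-++ []      v = refl
  drop-++ (x ∷ u) v = drop-++ u v

  rotate-++ : ∀ (u v : List A) → rotate (length u) (u ++ v) ≡ v ++ u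
  rotate-++ u v = cong₂ _++_ (drop-++ u v) (take-++ u v)

  ⟳-rotate : ∀ i (w : List A) → w ⟳ rotate i w
  ⟳-rotate i w = subst (_⟳ rotate i w) (L.take++drop≡id i w) (++-⟳ (take i w) (drop i w))

  nonEmpty⇒≢[] : ∀ (w : List A) → T (nonEmpty w) → w ≢ []
  nonEmpty⇒≢[] (_ ∷ _) _ ()

  ≢[]⇒nonEmpty : ∀ (w : List A) → w ≢ [] → T (nonEmpty w)
  ≢[]⇒nonEmpty []      ne = ne refl
  ≢[]⇒nonEmpty (_ ∷ _) ne = tt

  length-concat-replicate : ∀ n (w : List A) → length (concat (replicate n w)) ≡ n * length w
  length-concat-replicate zero    w = refl
  length-concat-replicate (suc n) w = trans (L.length-++ w) (cong (length w +_) (length-concat-replicate n w))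

  ⟳-singleton : ∀ {w} {x : A} → w ⟳ [ x ] → w ≡ [ x ]
  ⟳-singleton p = Perm.↭-singleton-inv (⟳⇒↭ p)

module _ {A : Set} where

  concat-↭ : ∀ {xss yss : List (List A)} → xss ↭ yss → concat xss ↭ concat yss
  concat-↭ ↭.refl           = ↭-refl
  concat-↭ (↭.prep xs p)    = Perm.++⁺ˡ xs (concat-↭ p)
  concat-↭ (↭.swap xs ys p) = ↭-trans (Perm.shifts xs ys) (Perm.++⁺ˡ ys (Perm.++⁺ˡ xs (concat-↭ p)))
  concat-↭ (↭.trans p q)    = ↭-trans (concat-↭ p) (concat-↭ q)

  concat-map-↭ : ∀ {f : List A → List A} → (∀ w → f w ↭ w) → ∀ ws → concat (map f ws) ↭ concat ws
  concat-map-↭ f↭ []       = ↭-refl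
  concat-map-↭ f↭ (w ∷ ws) = Perm.++⁺ (f↭ w) (concat-map-↭ f↭ ws)

  filter-partition-↭ : ∀ {P : A → Set} (P? : Decidable P) xs → filter P? xs ++ filter (∁? P?) xs ↭ xs
  filter-partition-↭ P? []       = ↭-refl
  filter-partition-↭ P? (x ∷ xs) with P? x
  ... | yes _ = ↭.prep x (filter-partition-↭ P? xs)
  ... | no  _ = ↭-trans (Perm.shift x (filter P? xs) _) (↭.prep x (filter-partition-↭ P? xs))

  countB-↭ : ∀ (p : A → Bool) {xs ys} → xs ↭ ys → countB p xs ≡ countB p ys
  countB-↭ p ↭.refl         = refl
  countB-↭ p (↭.prep x q)   = cong (_ +_) (countB-↭ p q)
  countB-↭ p (↭.swap x y q) with p x | p y
  ... | true  | true  = cong (2 +_) (countB-↭ p q)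
  ... | true  | false = cong suc (countB-↭ p q)
  ... | false | true  = cong suc (countB-↭ p q)
  ... | false | false = countB-↭ p q
  countB-↭ p (↭.trans q r)  = trans (countB-↭ p q) (countB-↭ p r)

  countB-filter : ∀ (p : A → Bool) xs → countB p xs ≡ length (filter (T? ∘ p) xs)
  countB-filter p []       = refl
  countB-filter p (x ∷ xs) with p x
  ... | true  = cong suc (countB-filter p xs)
  ... | false = countB-filter p xs

  sortedBy⇒Linked : ∀ (r : A → A → Bool) xs → T (sortedBy r xs) → Linked (λ x y → T (r x y)) xs
  sortedBy⇒Linked r []           _ = []
  sortedBy⇒Linked r (x ∷ [])     _ = [-]
  sortedBy⇒Linked r (x ∷ y ∷ xs) p =
    proj₁ (T-∧⁻ {r x y} p) ∷ sortedBy⇒Linked r (y ∷ xs) (proj₂ (T-∧⁻ {r x y} p))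

  Linked⇒sortedBy : ∀ (r : A → A → Bool) {xs} → Linked (λ x y → T (r x y)) xs → T (sortedBy r xs)
  Linked⇒sortedBy r []      = tt
  Linked⇒sortedBy r [-]     = tt
  Linked⇒sortedBy r (p ∷ q) = T-∧⁺ p (Linked⇒sortedBy r q)

module _ {A : Set} {R : A → A → Set} where

  Linked-∷ʳ⁺ : ∀ w {x y} → Linked R (w ∷ʳ x) → R x y → Linked R (w ∷ʳ x ∷ʳ y)
  Linked-∷ʳ⁺ []          [-]     q = q ∷ [-]
  Linked-∷ʳ⁺ (_ ∷ [])    (p ∷ r) q = p ∷ Linked-∷ʳ⁺ [] r q
  Linked-∷ʳ⁺ (_ ∷ _ ∷ w) (p ∷ r) q = p ∷ Linked-∷ʳ⁺ (_ ∷ w) r q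

  Linked-∷ʳ⁻ : ∀ w {x y} → Linked R (w ∷ʳ x ∷ʳ y) → Linked R (w ∷ʳ x) × R x y
  Linked-∷ʳ⁻ []          (p ∷ [-]) = [-] , p
  Linked-∷ʳ⁻ (_ ∷ [])    (p ∷ r)   with Linked-∷ʳ⁻ [] r
  ... | s , q = p ∷ s , q
  Linked-∷ʳ⁻ (_ ∷ _ ∷ w) (p ∷ r)   with Linked-∷ʳ⁻ (_ ∷ w) r
  ... | s , q = p ∷ s , q

module Sorting {A : Set} {_≼_ : A → A → Set} (isDecTotalOrder : IsDecTotalOrder _≡_ _≼_) where

  order : DecTotalOrder 0ℓ 0ℓ 0ℓ
  order = record { isDecTotalOrder = isDecTotalOrder }

  open Sort order public using (sort; sort-↭; sort-↗)

  sorted-unique : ∀ {xs ys} → Linked _≼_ xs → Linked _≼_ ys → xs ↭ ys → xs ≡ ys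
  sorted-unique s t p = Pointwise-≡⇒≡ (Sorted.↗↭↗⇒≋ (DecTotalOrder.totalOrder order) s t
    (Homogeneous.map (DecTotalOrder.Eq.reflexive order) (↭⇒↭ₛ p)))

hasWeight-↭ : ∀ α {xs ys} → xs ↭ ys → T (hasWeight α xs) → T (hasWeight α ys)
hasWeight-↭ α {xs} {ys} p h with T-∧⁻ {all (λ u → u <ᵇ length α) xs} h
... | q , r = T-∧⁺ (All.all⁻ (λ u → u <ᵇ length α) (Perm.All-resp-↭ p (All.all⁺ _ xs q)))
  (fromWitness (trans (L.map-cong (λ u → sym (countB-↭ (λ v → v ≡ᵇ u) p)) (upTo (length α))) (toWitness r)))

module _ {k : ℕ} where

  open import Data.Nat using (_*_)

  private
    l = suc k
    Word = List (Letter l)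

  -- Colored letters

  rank≡ : ∀ (x : Letter l) → rank x ≡ absL x * suc l + costL x
  rank≡ (col u m) = refl
  rank≡ (bar u)   = refl

  costL≤ : ∀ (x : Letter l) → costL x ≤ l
  costL≤ (col u m) = ℕ.<⇒≤ (Fin.toℕ<n m)
  costL≤ (bar u)   = ℕ.≤-refl

  abstract
    -- Inverse of the coordinates (`absL`, `costL`), with color l for the bar; larger colors also
    -- default to the bar. Kept abstract so that only the three laws below are visible.
    mk : ℕ → ℕ → Letter l
    mk u c with c <? l
    ... | yes p = col u (fromℕ< p)
    ... | no  _ = bar u

    absL-mk : ∀ u c → absL (mk u c) ≡ u
    absL-mk u c with c <? l
    ... | yes _ = refl
    ... | no  _ = refl

    costL-mk : ∀ u {c} → c ≤ l → costL (mk u c) ≡ c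
    costL-mk u {c} c≤l with c <? l
    ... | yes p = Fin.toℕ-fromℕ< p
    ... | no ¬p = ℕ.≤-antisym (ℕ.≮⇒≥ ¬p) c≤l

    mk-η : ∀ x → mk (absL x) (costL x) ≡ x
    mk-η (col u m) with toℕ m <? l
    ... | yes p = cong (col u) (Fin.fromℕ<-toℕ m p)
    ... | no ¬p = ⊥-elim (¬p (Fin.toℕ<n m))
    mk-η (bar u) with l <? l
    ... | yes p = ⊥-elim (ℕ.<-irrefl refl p)
    ... | no _  = refl

  rank≤⇒absL≤ : ∀ (x y : Letter l) → rank x ≤ rank y → absL x ≤ absL y
  rank≤⇒absL≤ x y p = ℕ.≮⇒≥ λ q → ℕ.<-irrefl refl (begin-strict
    rank y                      ≡⟨ rank≡ y ⟩
    absL y * suc l + costL y    ≤⟨ ℕ.+-monoʳ-≤ (absL y * suc l) (costL≤ y) ⟩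
    absL y * suc l + l          <⟨ ℕ.+-monoʳ-< (absL y * suc l) ℕ.≤-refl ⟩
    absL y * suc l + suc l      ≡⟨ ℕ.+-comm (absL y * suc l) (suc l) ⟩
    suc (absL y) * suc l        ≤⟨ ℕ.*-monoˡ-≤ (suc l) q ⟩
    absL x * suc l              ≤⟨ ℕ.m≤m+n _ (costL x) ⟩
    absL x * suc l + costL x    ≡⟨ rank≡ x ⟨
    rank x                      ≤⟨ p ⟩
    rank y ∎)
    where open ℕ.≤-Reasoning

  rank-injective : ∀ {x y : Letter l} → rank x ≡ rank y → x ≡ y
  rank-injective {x} {y} eq = trans (sym (mk-η x)) (trans (cong₂ mk abs≡ cost≡) (mk-η y))
    where
    abs≡ : absL x ≡ absL y
    abs≡ = ℕ.≤-antisym (rank≤⇒absL≤ x y (ℕ.≤-reflexive eq)) (rank≤⇒absL≤ y x (ℕ.≤-reflexive (sym eq)))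
    cost≡ : costL x ≡ costL y
    cost≡ = ℕ.+-cancelˡ-≡ (absL x * suc l) _ _ (begin
      absL x * suc l + costL x ≡⟨ rank≡ x ⟨
      rank x                   ≡⟨ eq ⟩
      rank y                   ≡⟨ rank≡ y ⟩
      absL y * suc l + costL y ≡⟨ cong (λ u → u * suc l + costL y) abs≡ ⟨
      absL x * suc l + costL y ∎)
      where open ≡-Reasoning

  _⊏_ : Letter l → Letter l → Set
  x ⊏ y = rank x < rank y

  ⊏-isStrictTotalOrder : IsStrictTotalOrder _≡_ _⊏_
  ⊏-isStrictTotalOrder = record
    { isStrictPartialOrder = record
      { isEquivalence = isEquivalence
      ; irrefl        = λ { refl → ℕ.<-irrefl refl }
      ; trans         = ℕ.<-trans
      ; <-resp-≈      = resp₂ _⊏_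
      }
    ; compare = compare
    }
    where
    compare : ∀ x y → _
    compare x y with ℕ.<-cmp (rank x) (rank y)
    ... | tri< p ¬q ¬r = tri< p (λ eq → ¬q (cong rank eq)) ¬r
    ... | tri≈ ¬p q ¬r = tri≈ ¬p (rank-injective q) ¬r
    ... | tri> ¬p ¬q r = tri> ¬p (λ eq → ¬q (cong rank eq)) r

  -- The representatives chosen in Defs are the Lyndon words for Inc; the factorization of
  -- banners uses Dec, whose Lyndon words of length at least two end in a letter of smaller rank
  -- than their first one, so that a barred last letter would violate the necklace condition.
  module Inc = Lex ⊏-isStrictTotalOrder
  module Dec = Lex (Flip.isStrictTotalOrder ⊏-isStrictTotalOrder)

  -- The necklace conditions (1) and (2) in color coordinates, where complementing the color visibly
  -- exchanges them.
  Ok : Letter l → Letter l → Set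
  Ok x y = (costL x ≡ l → absL y ≤ absL x) × (costL x ≡ 0 → absL x ≤ absL y)

  okPair⇒Ok : ∀ x y → T (okPair (x , y)) → Ok x y
  okPair⇒Ok (bar u)               y p = (λ _ → ℕ.≤ᵇ⇒≤ _ _ p) , (λ ())
  okPair⇒Ok (col u Fin.zero)      y p = (λ ()) , (λ _ → ℕ.≤ᵇ⇒≤ _ _ p)
  okPair⇒Ok (col u m@(Fin.suc _)) y p = (λ eq → ⊥-elim (ℕ.<-irrefl eq (Fin.toℕ<n m))) , (λ ())

  Ok⇒okPair : ∀ x y → Ok x y → T (okPair (x , y))
  Ok⇒okPair (bar u)             y (p , q) = ℕ.≤⇒≤ᵇ (p refl)
  Ok⇒okPair (col u Fin.zero)    y (p , q) = ℕ.≤⇒≤ᵇ (q refl)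
  Ok⇒okPair (col u (Fin.suc _)) y (p , q) = _

  -- Necklaces and banners

  Circular : List (Letter l) → Set
  Circular []       = ⊤
  Circular (x ∷ xs) = Linked Ok (x ∷ xs ∷ʳ x)

  okPairs⇒Linked : ∀ x xs z → T (all okPair (zip (x ∷ xs) (xs ∷ʳ z))) → Linked Ok (x ∷ xs ∷ʳ z)
  okPairs⇒Linked x []       z p = okPair⇒Ok x z (proj₁ (T-∧⁻ p)) ∷ [-]
  okPairs⇒Linked x (y ∷ xs) z p with T-∧⁻ {okPair (x , y)} p
  ... | q , r = okPair⇒Ok x y q ∷ okPairs⇒Linked y xs z r

  Linked⇒okPairs : ∀ x xs z → Linked Ok (x ∷ xs ∷ʳ z) → T (all okPair (zip (x ∷ xs) (xs ∷ʳ z)))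
  Linked⇒okPairs x []       z (p ∷ _) = T-∧⁺ (Ok⇒okPair x z p) tt
  Linked⇒okPairs x (y ∷ xs) z (p ∷ q) = T-∧⁺ (Ok⇒okPair x y p) (Linked⇒okPairs y xs z q)

  okPairs⇒Circular : ∀ w → T (all okPair (succPairs w)) → Circular w
  okPairs⇒Circular []       _ = tt
  okPairs⇒Circular (x ∷ xs) p = okPairs⇒Linked x xs x p

  Circular⇒okPairs : ∀ w → Circular w → T (all okPair (succPairs w))
  Circular⇒okPairs []       _ = tt
  Circular⇒okPairs (x ∷ xs) p = Linked⇒okPairs x xs x p

  Circular-⟳ : ∀ {v w} → v ⟳ w → Circular v → Circular w
  Circular-⟳ done                   c       = c
  Circular-⟳ (step {x} {[]} p)      c       = Circular-⟳ p c
  Circular-⟳ (step {x} {y ∷ ys} p)  (q ∷ c) = Circular-⟳ p (Linked-∷ʳ⁺ (y ∷ ys) c q)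

  -- The condition on the last letter says that it is unbarred.
  Banner : List (Letter l) → Set
  Banner []          = ⊤
  Banner (x ∷ [])    = costL x < l
  Banner (x ∷ y ∷ w) = Ok x y × Banner (y ∷ w)

  Banner-++ : ∀ w {z v} → Linked Ok (w ∷ʳ z) → Banner (z ∷ v) → Banner (w ++ z ∷ v)
  Banner-++ []          p       b = b
  Banner-++ (_ ∷ [])    (p ∷ _) b = p , b
  Banner-++ (_ ∷ _ ∷ w) (p ∷ q) b = p , Banner-++ (_ ∷ w) q b

  Banner-++⁻ : ∀ w {z v} → Banner (w ++ z ∷ v) → Linked Ok (w ∷ʳ z) × Banner (z ∷ v)
  Banner-++⁻ []          b       = [-] , b
  Banner-++⁻ (_ ∷ [])    (p , b) = p ∷ [-] , b
  Banner-++⁻ (_ ∷ y ∷ w) (p , b) with Banner-++⁻ (y ∷ w) b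
  ... | q , b′ = p ∷ q , b′

  Banner-tail : ∀ z v → Banner (z ∷ v) → Banner v
  Banner-tail z []      b       = tt
  Banner-tail z (_ ∷ v) (_ , b) = b

  Banner-∷ : ∀ {z} v → costL z < l → (∀ {y v′} → v ≡ y ∷ v′ → Ok z y) → Banner v → Banner (z ∷ v)
  Banner-∷ []      c ok b = c
  Banner-∷ (y ∷ v) c ok b = ok refl , b

  -- Against the one-letter suffix the comparison must be decided at once, since no word precedes
  -- the empty one; the order of `Dec` is reversed.
  last-rank : ∀ {x} xs z → Dec.Lyndon (x ∷ xs ∷ʳ z) → rank z < rank x
  last-rank xs z ly with ly xs z [] refl
  ... | Dec.this p  = p
  ... | Dec.next ()  

  unbarred-Ok : ∀ z y → costL z < l → rank z ≤ rank y → Ok z y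
  unbarred-Ok z y c r = (λ eq → ⊥-elim (ℕ.<-irrefl eq c)) , λ _ → rank≤⇒absL≤ z y r

  barred-rank : ∀ z y → costL z ≡ l → absL y ≤ absL z → rank y ≤ rank z
  barred-rank z y c a = begin
    rank y                   ≡⟨ rank≡ y ⟩
    absL y * suc l + costL y ≤⟨ ℕ.+-mono-≤ (ℕ.*-monoˡ-≤ (suc l) a) (costL≤ y) ⟩
    absL z * suc l + l       ≡⟨ cong (absL z * suc l +_) c ⟨
    absL z * suc l + costL z ≡⟨ rank≡ z ⟨
    rank z ∎
    where open ℕ.≤-Reasoning

  costL≢⇒< : ∀ (z : Letter l) → costL z ≢ l → costL z < l
  costL≢⇒< z ne = ℕ.≤∧≢⇒< (costL≤ z) ne

  ¬singleBar⇒ : ∀ x → T (not (singleBar [ x ])) → costL x < l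
  ¬singleBar⇒ (col u m) _ = Fin.toℕ<n m

  Circular⇒Banner : ∀ w → Dec.Lyndon w → Circular w → T (not (singleBar w)) → Banner w
  Circular⇒Banner (x ∷ xs) ly c ns with initLast xs
  ... | []       = ¬singleBar⇒ x ns
  ... | ys ∷ʳ′ z with Linked-∷ʳ⁻ (x ∷ ys) c
  ... | p , q = Banner-++ (x ∷ ys) p (costL≢⇒< z λ eq →
      ℕ.<⇒≱ (last-rank ys z ly) (barred-rank z x eq (proj₁ q eq)))

  -- Only the pair from last letter to first is new: the last letter is unbarred and of rank at most
  -- that of the first.
  Banner⇒Circular : ∀ w → Dec.Lyndon w → Banner w → Circular w
  Banner⇒Circular (x ∷ xs) ly b with initLast xs
  ... | []       = unbarred-Ok x x b ℕ.≤-refl ∷ [-]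
  ... | ys ∷ʳ′ z with Banner-++⁻ (x ∷ ys) b
  ... | p , c = Linked-∷ʳ⁺ (x ∷ ys) p (unbarred-Ok z x c (ℕ.<⇒≤ (last-rank ys z ly)))

  Banner⇒¬singleBar : ∀ w → Banner w → T (not (singleBar w))
  Banner⇒¬singleBar []                _ = tt
  Banner⇒¬singleBar (col _ _ ∷ [])    _ = tt
  Banner⇒¬singleBar (bar _ ∷ [])      b = ⊥-elim (ℕ.<-irrefl refl b)
  Banner⇒¬singleBar (col _ _ ∷ _ ∷ _) _ = tt
  Banner⇒¬singleBar (bar _ ∷ _ ∷ _)   _ = tt

  ≽-head : ∀ {x xs y ys} → x ∷ xs Dec.≽ y ∷ ys → rank x ≤ rank y
  ≽-head (inj₁ (Dec.this p)) = ℕ.<⇒≤ p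
  ≽-head (inj₁ (Dec.next p)) = ℕ.≤-refl
  ≽-head (inj₂ refl)         = ℕ.≤-refl

  head-concat : ∀ {x xs ws y v} → All Dec.Lyndon ws → Linked Dec._≽_ ((x ∷ xs) ∷ ws) → concat ws ≡ y ∷ v → rank x ≤ rank y
  head-concat {ws = []}            _ _       ()
  head-concat {ws = (_ ∷ _) ∷ ws}  _ (p ∷ _) refl = ≽-head p
  head-concat {ws = [] ∷ ws}       (() ∷ _)

  -- At a seam the last letter of a factor is unbarred, of rank at most that of its first letter,
  -- hence at most that of the next factor's first letter.
  Banner-concat : ∀ {ws} → All Dec.Lyndon ws → Linked Dec._≽_ ws → All Banner ws → Banner (concat ws)
  Banner-concat [] _ [] = tt
  Banner-concat {(x ∷ xs) ∷ ws} (ly ∷ lys) s (b ∷ bs) with initLast xs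
  ... | [] = Banner-∷ (concat ws) b
        (λ {y} eq → unbarred-Ok x y b (head-concat lys s eq)) (Banner-concat lys (Linked.tail s) bs)
  ... | ys ∷ʳ′ z with Banner-++⁻ (x ∷ ys) b
  ... | p , c = subst Banner (sym (L.++-assoc (x ∷ ys) [ z ] (concat ws))) (Banner-++ (x ∷ ys) p
        (Banner-∷ (concat ws) c
          (λ {y} eq → unbarred-Ok z y c (ℕ.≤-trans (ℕ.<⇒≤ (last-rank ys z ly)) (head-concat lys s eq)))
          (Banner-concat lys (Linked.tail s) bs)))

  -- A barred last letter would bound the rank of the next head from above. For a factor of length
  -- at least two this contradicts the strict drop from first to last letter; a single barred letter
  -- forces the next factor to be the same single letter, already known to be unbarred by induction
  -- from the end.
  Banner-concat⁻ : ∀ {ws} → All Dec.Lyndon ws → Linked Dec._≽_ ws → Banner (concat ws) → All Banner ws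
  Banner-concat⁻ [] _ _ = []
  Banner-concat⁻ {(x ∷ xs) ∷ ws} (ly ∷ lys) s b with initLast xs
  ... | [] = costL≢⇒< x (unbarred ws lys bs s b) ∷ bs
    where
    bs = Banner-concat⁻ lys (Linked.tail s) (Banner-tail x (concat ws) b)
    unbarred : ∀ ws → All Dec.Lyndon ws → All Banner ws → Linked Dec._≽_ ([ x ] ∷ ws) →
               Banner (x ∷ concat ws) → costL x ≢ l
    unbarred [] _ _ _ c eq = ℕ.<-irrefl eq c
    unbarred ([] ∷ ws) (() ∷ _)
    unbarred ((y ∷ []) ∷ ws) _ (by ∷ _) (p ∷ _) (q , _) eq =
      ℕ.<-irrefl (trans (cong costL (sym x≡y)) eq) by
      where
      x≡y : x ≡ y
      x≡y = rank-injective (ℕ.≤-antisym (≽-head p) (barred-rank x y eq (proj₁ q eq)))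
    unbarred ((y ∷ _ ∷ _) ∷ ws) _ _ (inj₁ (Dec.this p) ∷ _) (q , _) eq =
      ℕ.<⇒≱ p (barred-rank x y eq (proj₁ q eq))
    unbarred ((y ∷ _ ∷ _) ∷ ws) _ _ (inj₁ (Dec.next ()) ∷ _)
  Banner-concat⁻ {(x ∷ xs) ∷ ws} (ly ∷ lys) s b | ys ∷ʳ′ z
    with Banner-++⁻ (x ∷ ys) (subst Banner (L.++-assoc (x ∷ ys) [ z ] (concat ws)) b)
  ... | p , b′ = Banner-++ (x ∷ ys) p (costL≢⇒< z λ eq → unbarred eq (concat ws) refl b′) ∷
                 Banner-concat⁻ lys (Linked.tail s) (Banner-tail z (concat ws) b′)
    where
    unbarred : costL z ≡ l → ∀ v → concat ws ≡ v → Banner (z ∷ v) → ⊥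
    unbarred eq []      _ c       = ℕ.<-irrefl eq c
    unbarred eq (y ∷ v) e (q , _) = ℕ.<⇒≱ (last-rank ys z ly)
      (ℕ.≤-trans (head-concat lys s e) (barred-rank z y eq (proj₁ q eq)))

  -- The reflection of banners

  wordCost : List (Letter l) → ℕ
  wordCost w = sum (map costL w)

  lastCost : List (Letter l) → ℕ
  lastCost []          = 0
  lastCost (x ∷ [])    = costL x
  lastCost (x ∷ y ∷ w) = lastCost (y ∷ w)

  Banner⇒lastCost≤ : ∀ w → Banner w → lastCost w ≤ k
  Banner⇒lastCost≤ []          b       = z≤n
  Banner⇒lastCost≤ (x ∷ [])    b       = ℕ.≤-pred b
  Banner⇒lastCost≤ (x ∷ y ∷ w) (_ , b) = Banner⇒lastCost≤ (y ∷ w) b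

  -- The word u₁^{c₁} ⋯ u_N^{c_N} with barred letters regarded as having color l is sent to
  -- u_N^{l - c_{N-1}} ⋯ u₂^{l - c₁} u₁^{l - 1 - c_N}.
  reflectOnto : Letter l → List (Letter l) → List (Letter l) → List (Letter l)
  reflectOnto x []       acc = acc
  reflectOnto x (y ∷ ys) acc = reflectOnto y ys (mk (absL y) (l ∸ costL x) ∷ acc)

  reflectWith : ℕ → List (Letter l) → List (Letter l)
  reflectWith e []       = []
  reflectWith e (x ∷ xs) = reflectOnto x xs [ mk (absL x) e ]

  reflect : List (Letter l) → List (Letter l)
  reflect w = reflectWith (k ∸ lastCost w) w

  setLast : ℕ → Letter l → List (Letter l) → List (Letter l)
  setLast e x []       = [ mk (absL x) e ]
  setLast e x (y ∷ ys) = x ∷ setLast e y ys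

  setLast-lastCost : ∀ x xs → setLast (lastCost (x ∷ xs)) x xs ≡ x ∷ xs
  setLast-lastCost x []       = cong [_] (mk-η x)
  setLast-lastCost x (y ∷ ys) = cong (x ∷_) (setLast-lastCost y ys)

  complement : Letter l → ℕ → Letter l
  complement x u = mk u (l ∸ costL x)

  costL-complement : ∀ x u → costL (complement x u) ≡ l ∸ costL x
  costL-complement x u = costL-mk u (ℕ.m∸n≤m l (costL x))

  -- The second pass first reads the letters produced from `xs`; on reaching `a` it has rebuilt x ∷
  -- xs except for the last color, which is the parameter `e`.
  reflectWith-reflectOnto : ∀ e x xs a as → absL a ≡ absL x →
    reflectWith e (reflectOnto x xs (a ∷ as)) ≡ reflectOnto a as (setLast e x xs)
  reflectWith-reflectOnto e x []       a as eq = cong (λ u → reflectOnto a as [ mk u e ]) eq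
  reflectWith-reflectOnto e x (y ∷ ys) a as eq = begin
    reflectWith e (reflectOnto y ys (b ∷ a ∷ as))               ≡⟨ reflectWith-reflectOnto e y ys b (a ∷ as) (absL-mk _ _) ⟩
    reflectOnto a as (mk (absL a) (l ∸ costL b) ∷ setLast e y ys) ≡⟨ cong (λ x → reflectOnto a as (x ∷ setLast e y ys)) mk≡ ⟩
    reflectOnto a as (x ∷ setLast e y ys) ∎
    where
    open ≡-Reasoning
    b = complement x (absL y)
    mk≡ : mk (absL a) (l ∸ costL b) ≡ x
    mk≡ = trans (cong₂ mk eq (trans (cong (l ∸_) (costL-complement x (absL y))) (ℕ.m∸[m∸n]≡n (costL≤ x)))) (mk-η x)

  lastCost-reflectOnto : ∀ x xs a as → lastCost (reflectOnto x xs (a ∷ as)) ≡ lastCost (a ∷ as)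
  lastCost-reflectOnto x []       a as = refl
  lastCost-reflectOnto x (y ∷ ys) a as = lastCost-reflectOnto y ys _ (a ∷ as)

  reflect-involutive : ∀ w → Banner w → reflect (reflect w) ≡ w
  reflect-involutive []       _ = refl
  reflect-involutive w@(x ∷ xs) b = begin
    reflect (reflect w)                                         ≡⟨ reflectWith-reflectOnto _ x xs a [] (absL-mk (absL x) _) ⟩
    setLast (k ∸ lastCost (reflectOnto x xs [ a ])) x xs        ≡⟨ cong (λ e → setLast e x xs) eq ⟩
    setLast (lastCost w) x xs                                   ≡⟨ setLast-lastCost x xs ⟩
    w ∎
    where
    open ≡-Reasoning
    a = mk (absL x) (k ∸ lastCost w)
    eq : k ∸ lastCost (reflectOnto x xs [ a ]) ≡ lastCost w
    eq = begin
      k ∸ lastCost (reflectOnto x xs [ a ]) ≡⟨ cong (k ∸_) (lastCost-reflectOnto x xs a []) ⟩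
      k ∸ costL a                           ≡⟨ cong (k ∸_) (costL-mk (absL x) (ℕ.≤-trans (ℕ.m∸n≤m k (lastCost w)) (ℕ.n≤1+n k))) ⟩
      k ∸ (k ∸ lastCost w)                  ≡⟨ ℕ.m∸[m∸n]≡n (Banner⇒lastCost≤ w b) ⟩
      lastCost w ∎

  -- The pair x, y becomes a pair with the two absolute values exchanged and the leading color
  -- complemented, so condition (2) for x, y yields (1) for the new pair, and (1) yields (2).
  Banner-reflectOnto : ∀ x xs a as → absL a ≡ absL x → Banner (x ∷ xs) → Banner (a ∷ as) →
                       Banner (reflectOnto x xs (a ∷ as))
  Banner-reflectOnto x []       a as eq _               b′ = b′
  Banner-reflectOnto x (y ∷ ys) a as eq ((p , q) , b) b′ =
    Banner-reflectOnto y ys (complement x (absL y)) (a ∷ as) (absL-mk _ _) b ((p′ , q′) , b′)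
    where
    p′ : costL (complement x (absL y)) ≡ l → absL a ≤ absL (complement x (absL y))
    p′ e = subst₂ _≤_ (sym eq) (sym (absL-mk _ _)) (q (ℕ.+-cancelˡ-≡ l _ _ (begin
      l + costL x             ≡⟨ cong (_+ costL x) (trans (sym (costL-complement x (absL y))) e) ⟨
      (l ∸ costL x) + costL x ≡⟨ ℕ.m∸n+n≡m (costL≤ x) ⟩
      l                       ≡⟨ ℕ.+-identityʳ l ⟨
      l + 0 ∎)))
      where open ≡-Reasoning
    q′ : costL (complement x (absL y)) ≡ 0 → absL (complement x (absL y)) ≤ absL a
    q′ e = subst₂ _≤_ (sym (absL-mk _ _)) (sym eq)
      (p (ℕ.≤-antisym (costL≤ x) (ℕ.m∸n≡0⇒m≤n (trans (sym (costL-complement x (absL y))) e))))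

  reflect-Banner : ∀ w → Banner w → Banner (reflect w)
  reflect-Banner []       b = tt
  reflect-Banner w@(x ∷ xs) b = Banner-reflectOnto x xs _ [] (absL-mk _ _) b
    (ℕ.≤-trans (ℕ.≤-reflexive (cong suc (costL-mk (absL x) (ℕ.≤-trans le (ℕ.n≤1+n k))))) (s≤s le))
    where
    le : k ∸ lastCost w ≤ k
    le = ℕ.m∸n≤m k (lastCost w)

  absL-reflectOnto : ∀ x xs acc → map absL (reflectOnto x xs acc) ↭ map absL xs ++ map absL acc
  absL-reflectOnto x []       acc = ↭-refl
  absL-reflectOnto x (y ∷ ys) acc = ↭-trans (absL-reflectOnto y ys _)
    (↭-trans (↭-reflexive (cong (λ u → map absL ys ++ u ∷ map absL acc) (absL-mk _ _))) (Perm.shift (absL y) (map absL ys) (map absL acc)))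

  absL-reflect : ∀ w → map absL (reflect w) ↭ map absL w
  absL-reflect []       = ↭-refl
  absL-reflect (x ∷ xs) = ↭-trans (absL-reflectOnto x xs _)
    (↭-trans (↭-reflexive (cong (λ u → map absL xs ++ [ u ]) (absL-mk _ _))) (↭-sym (Perm.∷↭∷ʳ (absL x) (map absL xs))))

  -- Each letter with a successor contributes c and l - c. The last color has not been complemented
  -- here, whence the extra summand.
  wordCost-reflectOnto : ∀ x xs acc →
    wordCost (reflectOnto x xs acc) + wordCost (x ∷ xs) ≡ length xs * l + wordCost acc + lastCost (x ∷ xs)
  wordCost-reflectOnto x []       acc = cong (wordCost acc +_) (ℕ.+-identityʳ (costL x))
  wordCost-reflectOnto x (y ∷ ys) acc = begin
    R + (costL x + W)                                   ≡⟨ solve 3 (λ r c w → r :+ (c :+ w) := (r :+ w) :+ c) refl R (costL x) W ⟩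
    R + W + costL x                                     ≡⟨ cong (_+ costL x) (wordCost-reflectOnto y ys _) ⟩
    n + (costL b + A) + e + costL x                     ≡⟨ cong (λ c → n + (c + A) + e + costL x) (costL-complement x (absL y)) ⟩
    n + (l ∸ costL x + A) + e + costL x                 ≡⟨ solve 5 (λ n d a e c → n :+ (d :+ a) :+ e :+ c := (d :+ c) :+ n :+ a :+ e) refl n (l ∸ costL x) A e (costL x) ⟩
    (l ∸ costL x + costL x) + n + A + e                 ≡⟨ cong (λ c → c + n + A + e) (ℕ.m∸n+n≡m (costL≤ x)) ⟩
    l + n + A + e ∎
    where
    open ≡-Reasoning
    open +-*-Solver
    b = complement x (absL y)
    R = wordCost (reflectOnto y ys (b ∷ acc))
    W = wordCost (y ∷ ys)
    n = length ys * l
    A = wordCost acc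
    e = lastCost (y ∷ ys)

  wordCost-reflect : ∀ w → w ≢ [] → Banner w → suc (wordCost (reflect w) + wordCost w) ≡ length w * l
  wordCost-reflect []       ne _ = ⊥-elim (ne refl)
  wordCost-reflect w@(x ∷ xs) _ b = begin
    suc (wordCost (reflect w) + wordCost w)         ≡⟨ cong suc (wordCost-reflectOnto x xs [ a ]) ⟩
    suc (n + (costL a + 0) + lastCost w)            ≡⟨ cong (λ c → suc (n + (c + 0) + lastCost w)) (costL-mk (absL x) (ℕ.≤-trans (ℕ.m∸n≤m k (lastCost w)) (ℕ.n≤1+n k))) ⟩
    suc (n + (k ∸ lastCost w + 0) + lastCost w)     ≡⟨ solve 3 (λ n d e → con 1 :+ (n :+ (d :+ con 0) :+ e) := con 1 :+ (d :+ e) :+ n) refl n (k ∸ lastCost w) (lastCost w) ⟩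
    suc (k ∸ lastCost w + lastCost w) + n           ≡⟨ cong (λ c → suc c + n) (ℕ.m∸n+n≡m (Banner⇒lastCost≤ w b)) ⟩
    l + n ∎
    where
    open ≡-Reasoning
    open +-*-Solver
    a = mk (absL x) (k ∸ lastCost w)
    n = length xs * l

  -- Representatives of necklaces

  lexLeq⇒≽ : ∀ (v w : List (Letter l)) → T (lexLeq (ranks v) (ranks w)) → w Inc.≽ v
  lexLeq⇒≽ []      []      _ = inj₂ refl
  lexLeq⇒≽ []      (y ∷ w) _ = inj₁ Inc.halt
  lexLeq⇒≽ (x ∷ v) (y ∷ w) p with T-∨⁻ {rank x <ᵇ rank y} p
  ... | inj₁ q = inj₁ (Inc.this (ℕ.<ᵇ⇒< _ _ q))
  ... | inj₂ q with T-∧⁻ {rank x ≡ᵇ rank y} q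
  ... | eq , r with rank-injective {x = x} {y} (ℕ.≡ᵇ⇒≡ _ _ eq) | lexLeq⇒≽ v w r
  ... | refl | inj₁ s    = inj₁ (Inc.next s)
  ... | refl | inj₂ refl = inj₂ refl

  ≽⇒lexLeq : ∀ {v w : List (Letter l)} → w Inc.≽ v → T (lexLeq (ranks v) (ranks w))
  ≽⇒lexLeq (inj₁ Inc.halt)     = tt
  ≽⇒lexLeq (inj₁ (Inc.this p)) = T-∨⁺ (inj₁ (ℕ.<⇒<ᵇ p))
  ≽⇒lexLeq {x ∷ v} (inj₁ (Inc.next p)) =
    T-∨⁺ {rank x <ᵇ rank x} (inj₂ (T-∧⁺ (ℕ.≡⇒≡ᵇ (rank x) _ refl) (≽⇒lexLeq (inj₁ p))))
  ≽⇒lexLeq {[]}    (inj₂ refl) = tt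
  ≽⇒lexLeq {x ∷ v} (inj₂ refl) =
    T-∨⁺ {rank x <ᵇ rank x} (inj₂ (T-∧⁺ (ℕ.≡⇒≡ᵇ (rank x) _ refl) (≽⇒lexLeq {v} (inj₂ refl))))

  isPower⇒Power : ∀ (w : List (Letter l)) → T (isPower w) → Power w
  isPower⇒Power w p with satisfied (Any.any⁻ _ (upTo (suc (length w))) p)
  ... | d , q with satisfied (Any.any⁻ _ (upTo (suc (length w))) q)
  ... | n , r with T-∧⁻ {2 ≤ᵇ n} r
  isPower⇒Power w p | d , q | suc (suc n) , r | _ , s = take d w , n , L.map-injective rank-injective (toWitness s)

  -- The Boolean search bounds both block length and exponent by the length of `w`; a nonempty block
  -- obeys both bounds.
  Power⇒isPower : ∀ (w : List (Letter l)) → w ≢ [] → Power w → T (isPower w)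
  Power⇒isPower w ne ([] , n , eq) = ⊥-elim (ne (trans eq (concat-replicate-[] n)))
  Power⇒isPower w ne (z@(_ ∷ _) , n , eq) =
    Any.any⁺ _ (lose (∈-upTo⁺ (s≤s d≤)) (Any.any⁺ (λ k → (2 ≤ᵇ k) ∧ eqW w (concat (replicate k (take (length z) w))))
      (lose (∈-upTo⁺ (s≤s n≤)) (fromWitness (cong ranks eq′)))))
    where
    len : length w ≡ (2 + n) * length z
    len = trans (cong length eq) (length-concat-replicate (2 + n) z)
    d≤ : length z ≤ length w
    d≤ = ℕ.≤-trans (ℕ.m≤m+n _ _) (ℕ.≤-reflexive (sym len))
    n≤ : 2 + n ≤ length w
    n≤ = ℕ.≤-trans (ℕ.m≤m*n (2 + n) (length z)) (ℕ.≤-reflexive (sym len))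
    eq′ : w ≡ concat (replicate (2 + n) (take (length z) w))
    eq′ = trans eq (cong (λ u → concat (replicate (2 + n) u))
            (sym (trans (cong (take (length z)) eq) (take-++ z _))))

  canonical⇒least : ∀ (w : List (Letter l)) {w′} → T (isCanonicalRep w) → w ⟳ w′ → w′ Inc.≽ w
  canonical⇒least w c p with ⟳-split p
  ... | u , [] , refl , refl = inj₂ (sym (L.++-identityʳ u))
  ... | u , v@(_ ∷ _) , refl , refl = subst (Inc._≽ u ++ v) (rotate-++ u v)
    (lexLeq⇒≽ (u ++ v) (rotate (length u) (u ++ v))
      (All.lookup (All.all⁺ _ (upTo (length (u ++ v))) c) (∈-upTo⁺ (begin-strict
        length u            <⟨ ℕ.m<m+n (length u) (s≤s z≤n) ⟩
        length u + length v ≡⟨ L.length-++ u ⟨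
        length (u ++ v) ∎))))
    where open ℕ.≤-Reasoning

  least⇒canonical : ∀ (w : List (Letter l)) → (∀ {w′} → w ⟳ w′ → w′ Inc.≽ w) → T (isCanonicalRep w)
  least⇒canonical w least =
    All.all⁻ (λ i → lexLeq (ranks w) (ranks (rotate i w))) (All.tabulate {xs = upTo (length w)} λ {i} _ → ≽⇒lexLeq (least (⟳-rotate i w)))

  ¬singleBar-⟳ : ∀ {v w : List (Letter l)} → v ⟳ w → T (not (singleBar v)) → T (not (singleBar w))
  ¬singleBar-⟳ {v} {[]}          p ns = tt
  ¬singleBar-⟳ {v} {col _ _ ∷ []} p ns = tt
  ¬singleBar-⟳ {v} {bar u ∷ []}  p ns with ⟳-singleton p
  ... | refl = ns
  ¬singleBar-⟳ {v} {col _ _ ∷ _ ∷ _} p ns = tt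
  ¬singleBar-⟳ {v} {bar _ ∷ _ ∷ _}   p ns = tt

  module _ (w : List (Letter l)) (nk : T (isNecklace w)) where

    necklace-≢[] : w ≢ []
    necklace-≢[] = nonEmpty⇒≢[] w (proj₁ (T-∧⁻ {nonEmpty w} (proj₁ (T-∧⁻ {isPrimitive w} nk))))

    necklace-¬Power : ¬ Power w
    necklace-¬Power p = T-not⁻ (proj₂ (T-∧⁻ {nonEmpty w} (proj₁ (T-∧⁻ {isPrimitive w} nk)))) (Power⇒isPower w necklace-≢[] p)

    private
      rest = proj₂ (T-∧⁻ {isPrimitive w} nk)
      rest′ = proj₂ (T-∧⁻ {isCanonicalRep w} rest)

    necklace-Circular : Circular w
    necklace-Circular = okPairs⇒Circular w (proj₁ (T-∧⁻ {all okPair (succPairs w)} rest′))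

    necklace-¬singleBar : T (not (singleBar w))
    necklace-¬singleBar = proj₂ (T-∧⁻ {all okPair (succPairs w)} rest′)

    -- A primitive word has a Lyndon rotation, and this rotation and `w` are both least in their
    -- rotation class.
    necklace-Lyndon : Inc.Lyndon w
    necklace-Lyndon = subst Inc.Lyndon
      (Inc.≽-antisym
        (canonical⇒least w (proj₁ (T-∧⁻ {isCanonicalRep w} rest)) (Inc.⟳-lyndonRotation w))
        (Inc.Lyndon-least ly (⟳-sym (Inc.⟳-lyndonRotation w))))
      ly
      where
      ly : Inc.Lyndon (Inc.lyndonRotation w)
      ly = Inc.Lyndon-lyndonRotation necklace-≢[] necklace-¬Power

  Lyndon⇒necklace : ∀ w → Inc.Lyndon w → Circular w → T (not (singleBar w)) → T (isNecklace w)
  Lyndon⇒necklace w ly c ns = T-∧⁺ (T-∧⁺ (≢[]⇒nonEmpty w (Inc.Lyndon⇒≢[] ly))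
      (T-not⁺ λ p → Inc.Lyndon⇒¬Power ly (isPower⇒Power w p)))
    (T-∧⁺ (least⇒canonical w (Inc.Lyndon-least ly)) (T-∧⁺ (Circular⇒okPairs w c) ns))

  GoodFactor : List (Letter l) → Set
  GoodFactor w = Dec.Lyndon w × Banner w

  -- The change between the two choices of representative of one circular word; uniqueness of Lyndon
  -- rotations makes the two maps mutually inverse on necklaces and good factors.
  toDec toInc : List (Letter l) → List (Letter l)
  toDec = Dec.lyndonRotation
  toInc = Inc.lyndonRotation

  toDec-good : ∀ w → T (isNecklace w) → GoodFactor (toDec w)
  toDec-good w nk = ly , Circular⇒Banner (toDec w) ly
      (Circular-⟳ rot (necklace-Circular w nk)) (¬singleBar-⟳ rot (necklace-¬singleBar w nk))
    where
    rot = Dec.⟳-lyndonRotation w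
    ly = Dec.Lyndon-lyndonRotation (necklace-≢[] w nk) (necklace-¬Power w nk)

  toInc-necklace : ∀ w → GoodFactor w → T (isNecklace (toInc w))
  toInc-necklace w (ly , b) = Lyndon⇒necklace (toInc w)
      (Inc.Lyndon-lyndonRotation (Dec.Lyndon⇒≢[] ly) (Dec.Lyndon⇒¬Power ly))
      (Circular-⟳ rot (Banner⇒Circular w ly b)) (¬singleBar-⟳ rot (Banner⇒¬singleBar w b))
    where
    rot = Inc.⟳-lyndonRotation w

  toInc-toDec : ∀ w → T (isNecklace w) → toInc (toDec w) ≡ w
  toInc-toDec w nk = sym (Inc.Lyndon-unique
    (⟳-trans (Dec.⟳-lyndonRotation w) (Inc.⟳-lyndonRotation (toDec w)))
    (necklace-Lyndon w nk) (necklace-Lyndon _ (toInc-necklace (toDec w) (toDec-good w nk))))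

  toDec-toInc : ∀ w → GoodFactor w → toDec (toInc w) ≡ w
  toDec-toInc w g = sym (Dec.Lyndon-unique
    (⟳-trans (Inc.⟳-lyndonRotation w) (Dec.⟳-lyndonRotation (toInc w)))
    (proj₁ g) (proj₁ (toDec-good (toInc w) (toInc-necklace w g))))

  -- The order is flipped so that being sorted means `Linked Dec._≽_`, the form in which Lyndon
  -- factorizations occur.
  module Decreasing = Sorting {Word} (StrictToNonStrict.isDecTotalOrder _≡_ _ (Flip.isStrictTotalOrder Dec.≺-isStrictTotalOrder))
  module Increasing = Sorting {Word} (StrictToNonStrict.isDecTotalOrder _≡_ _ Inc.≺-isStrictTotalOrder)
  module Numeric    = Sorting ℕ.≤-isDecTotalOrder

  -- Ornaments

  absLs : List Word → List ℕ
  absLs ws = map absL (concat ws)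

  absLs-↭ : ∀ {vs ws} → vs ↭ ws → absLs vs ↭ absLs ws
  absLs-↭ p = Perm.map⁺ absL (concat-↭ p)

  absLs-map : ∀ {f : Word → Word} → (∀ w → f w ↭ w) → ∀ ws → absLs (map f ws) ↭ absLs ws
  absLs-map f↭ ws = Perm.map⁺ absL (concat-map-↭ f↭ ws)

  absLs-++ : ∀ vs ws → absLs (vs ++ ws) ≡ absLs vs ++ absLs ws
  absLs-++ vs ws = trans (cong (map absL) (sym (L.concat-++ vs ws))) (L.map-++ absL (concat vs) (concat ws))

  wordCost-↭ : ∀ {v w : Word} → v ↭ w → wordCost v ≡ wordCost w
  wordCost-↭ p = sum-↭ (Perm.map⁺ costL p)

  cost-↭ : ∀ {vs ws : List Word} → vs ↭ ws → cost vs ≡ cost ws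
  cost-↭ p = wordCost-↭ (concat-↭ p)

  cost-map : ∀ {f : Word → Word} → (∀ w → f w ↭ w) → ∀ ws → cost (map f ws) ≡ cost ws
  cost-map f↭ ws = wordCost-↭ (concat-map-↭ f↭ ws)

  cost-++ : ∀ (vs ws : List Word) → cost (vs ++ ws) ≡ cost vs + cost ws
  cost-++ vs ws = begin
    wordCost (concat (vs ++ ws))                              ≡⟨ cong wordCost (L.concat-++ vs ws) ⟨
    wordCost (concat vs ++ concat ws)                         ≡⟨ cong sum (L.map-++ costL (concat vs) (concat ws)) ⟩
    sum (map costL (concat vs) ++ map costL (concat ws))      ≡⟨ sum-++ (map costL (concat vs)) _ ⟩
    cost vs + cost ws ∎
    where open ≡-Reasoning

  isFixed : Word → Bool
  isFixed w = (length w ≡ᵇ 1) ∧ all zeroColored w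

  Fixed : Word → Set
  Fixed w = T (isFixed w)

  Fixed? : Decidable Fixed
  Fixed? w = T? (isFixed w)

  fixed moved : List Word → List Word
  fixed = filter Fixed?
  moved = filter (∁? Fixed?)

  fixed-moved-↭ : ∀ ws → fixed ws ++ moved ws ↭ ws
  fixed-moved-↭ = filter-partition-↭ Fixed?

  Fixed-⟳ : ∀ {v w} → v ⟳ w → Fixed v → Fixed w
  Fixed-⟳ {x ∷ []} p f with ⟳-singleton (⟳-sym p)
  ... | refl = f

  singleton : ℕ → Word
  singleton u = [ col u Fin.zero ]

  letterOf : Word → ℕ
  letterOf []      = 0
  letterOf (x ∷ _) = absL x

  map-letterOf-singleton : ∀ us → map letterOf (map singleton us) ≡ us
  map-letterOf-singleton us = trans (sym (L.map-∘ us)) (L.map-id us)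

  -- `Fixed` alone admits a single barred letter, since the bar counts as 0-colored; the banner
  -- condition rules it out.
  singleton-letterOf : ∀ {w} → Banner w → Fixed w → singleton (letterOf w) ≡ w
  singleton-letterOf {col u Fin.zero ∷ []} _ _ = refl
  singleton-letterOf {bar u ∷ []}          b _ = ⊥-elim (ℕ.<-irrefl refl b)

  GoodFactor-singleton : ∀ u → GoodFactor (singleton u)
  GoodFactor-singleton u = Dec.Lyndon-[ _ ] , s≤s z≤n

  absLs-singleton : ∀ us → absLs (map singleton us) ≡ us
  absLs-singleton []       = refl
  absLs-singleton (u ∷ us) = cong (u ∷_) (absLs-singleton us)

  cost-singleton : ∀ us → cost (map singleton us) ≡ 0
  cost-singleton []       = refl
  cost-singleton (u ∷ us) = cost-singleton us

  fixed-map-singleton : ∀ us → All Fixed (map singleton us)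
  fixed-map-singleton []       = []
  fixed-map-singleton (u ∷ us) = tt ∷ fixed-map-singleton us

  map-singleton-letterOf : ∀ {ws} → All GoodFactor ws → map singleton (map letterOf (fixed ws)) ≡ fixed ws
  map-singleton-letterOf {ws} gs = trans (sym (L.map-∘ (fixed ws)))
    (L.map-id-local (All.zipWith (λ { ((_ , b) , f) → singleton-letterOf b f })
      (All.filter⁺ Fixed? gs , All.all-filter Fixed? ws)))

  Fixed-cost : ∀ {ws : List Word} → All (T ∘ isNecklace) ws → All Fixed ws → cost ws ≡ 0
  Fixed-cost [] [] = refl
  Fixed-cost {(col u Fin.zero ∷ []) ∷ ws} (_ ∷ nks) (_ ∷ fs) = Fixed-cost nks fs
  Fixed-cost {(bar u ∷ []) ∷ ws} (nk ∷ _) _ = ⊥-elim (necklace-¬singleBar (bar u ∷ []) nk)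
  Fixed-cost {[] ∷ _}                       _ (() ∷ _)
  Fixed-cost {(col u (Fin.suc _) ∷ []) ∷ _} _ (() ∷ _)
  Fixed-cost {(_ ∷ _ ∷ _) ∷ _}              _ (() ∷ _)

  Fixed-length : ∀ {ws} → All Fixed ws → length (concat ws) ≡ length ws
  Fixed-length []                    = refl
  Fixed-length {(x ∷ []) ∷ ws} (_ ∷ fs) = cong suc (Fixed-length fs)

  -- Conjugates `reflect` by Lyndon factorization: sorting puts the factors in the order in which
  -- `Dec.factor` recovers them from their concatenation.
  reflectAll : List Word → List Word
  reflectAll ws = Dec.factor (reflect (concat (Decreasing.sort ws)))

  module _ {ws : List Word} (gs : All GoodFactor ws) where

    private
      ws′ = Decreasing.sort ws
      gs′ = Perm.All-resp-↭ (↭-sym (Decreasing.sort-↭ ws)) gs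
      lys = All.map proj₁ gs′
      w   = concat ws′

    Banner-sort : Banner (concat (Decreasing.sort ws))
    Banner-sort = Banner-concat lys (Decreasing.sort-↗ ws) (All.map proj₂ gs′)

    private
      concat≡ : concat (reflectAll ws) ≡ reflect w
      concat≡ = Dec.concat-factor (reflect w)

    reflectAll-good : All GoodFactor (reflectAll ws)
    reflectAll-good = All.zip (Dec.factor-Lyndon (reflect w) ,
      Banner-concat⁻ (Dec.factor-Lyndon (reflect w)) (Dec.factor-≽ (reflect w))
        (subst Banner (sym concat≡) (reflect-Banner w Banner-sort)))

    -- Stated for any rearrangement `vs`, because decoding and encoding again returns the image only
    -- up to permutation.
    reflectAll-involutive : ∀ {vs} → vs ↭ reflectAll ws → reflectAll vs ↭ ws
    reflectAll-involutive {vs} p = ↭-trans (↭-reflexive (begin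
      Dec.factor (reflect (concat (Decreasing.sort vs)))   ≡⟨ cong (Dec.factor ∘ reflect ∘ concat) sort≡ ⟩
      Dec.factor (reflect (concat (reflectAll ws)))        ≡⟨ cong (Dec.factor ∘ reflect) concat≡ ⟩
      Dec.factor (reflect (reflect w))                     ≡⟨ cong Dec.factor (reflect-involutive w Banner-sort) ⟩
      Dec.factor w                                         ≡⟨ Dec.factor-concat lys (Decreasing.sort-↗ ws) ⟩
      ws′ ∎)) (Decreasing.sort-↭ ws)
      where
      open ≡-Reasoning
      sort≡ : Decreasing.sort vs ≡ reflectAll ws
      sort≡ = Decreasing.sorted-unique (Decreasing.sort-↗ vs) (Dec.factor-≽ (reflect w))
                (↭-trans (Decreasing.sort-↭ vs) p)

    absLs-reflectAll : absLs (reflectAll ws) ↭ absLs ws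
    absLs-reflectAll = ↭-trans (↭-reflexive (cong (map absL) concat≡))
      (↭-trans (absL-reflect w) (absLs-↭ (Decreasing.sort-↭ ws)))

    cost-reflectAll : concat ws ≢ [] → suc (cost (reflectAll ws) + cost ws) ≡ length (concat ws) * l
    cost-reflectAll ne = begin
      suc (cost (reflectAll ws) + cost ws)       ≡⟨ cong₂ (λ c d → suc (c + d)) (cong wordCost concat≡) (wordCost-↭ (↭-sym w↭)) ⟩
      suc (wordCost (reflect w) + wordCost w)    ≡⟨ wordCost-reflect w (λ eq → ne (Perm.↭-empty-inv (subst (concat ws ↭_) eq (↭-sym w↭)))) Banner-sort ⟩
      length w * l                               ≡⟨ cong (_* l) (Perm.↭-length w↭) ⟩
      length (concat ws) * l ∎
      where
      open ≡-Reasoning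
      w↭ : w ↭ concat ws
      w↭ = concat-↭ (Decreasing.sort-↭ ws)

  -- The involution on pairs of a variable multiset and an ornament

  toDec-↭ : ∀ (w : Word) → toDec w ↭ w
  toDec-↭ w = ↭-sym (⟳⇒↭ (Dec.⟳-lyndonRotation w))

  toInc-↭ : ∀ (w : Word) → toInc w ↭ w
  toInc-↭ w = ↭-sym (⟳⇒↭ (Inc.⟳-lyndonRotation w))

  moved-toDec : ∀ {ws} → All (∁ Fixed) ws → All (∁ Fixed) (map toDec ws)
  moved-toDec = All.map⁺ ∘ All.map (λ {w} ¬f f → ¬f (Fixed-⟳ (⟳-sym (Dec.⟳-lyndonRotation w)) f))

  moved-toInc : ∀ {ws} → All (∁ Fixed) ws → All (∁ Fixed) (map toInc ws)
  moved-toInc = All.map⁺ ∘ All.map (λ {w} ¬f f → ¬f (Fixed-⟳ (⟳-sym (Inc.⟳-lyndonRotation w)) f))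

  fixed-++ : ∀ {us vs} → All Fixed us → All (∁ Fixed) vs → fixed (us ++ vs) ≡ us
  fixed-++ {us} {vs} fs ms = begin
    fixed (us ++ vs)       ≡⟨ L.filter-++ Fixed? us vs ⟩
    fixed us ++ fixed vs   ≡⟨ cong₂ _++_ (L.filter-all Fixed? fs) (L.filter-none Fixed? ms) ⟩
    us ++ []               ≡⟨ L.++-identityʳ us ⟩
    us ∎
    where open ≡-Reasoning

  moved-++ : ∀ {us vs} → All Fixed us → All (∁ Fixed) vs → moved (us ++ vs) ≡ vs
  moved-++ {us} {vs} fs ms = begin
    moved (us ++ vs)       ≡⟨ L.filter-++ (∁? Fixed?) us vs ⟩
    moved us ++ moved vs   ≡⟨ cong₂ _++_ (L.filter-none (∁? Fixed?) (All.map (λ f ¬f → ¬f f) fs)) (L.filter-all (∁? Fixed?) ms) ⟩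
    vs ∎
    where open ≡-Reasoning

  all-fixed : ∀ ws → All Fixed (fixed ws)
  all-fixed = All.all-filter Fixed?

  all-moved : ∀ ws → All (∁ Fixed) (moved ws)
  all-moved = All.all-filter (∁? Fixed?)

  -- The variables of h_i become one-letter necklaces; the fixed necklaces of R are set aside.
  encode : List ℕ → List Word → List Word
  encode M R = map singleton M ++ map toDec (moved R)

  image : List ℕ → List Word → List Word
  image M R = reflectAll (encode M R)

  -- Every fixed factor of the image is read as a variable, whatever its origin; `Φ₂` puts back the
  -- fixed necklaces of `R` untouched, so their number stays j.
  Φ₁ : List ℕ → List Word → List ℕ
  Φ₁ M R = Numeric.sort (map letterOf (fixed (image M R)))

  Φ₂ : List ℕ → List Word → List Word
  Φ₂ M R = Increasing.sort (fixed R ++ map toInc (moved (image M R)))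

  absLs-split : ∀ ws → absLs (fixed ws) ++ absLs (moved ws) ↭ absLs ws
  absLs-split ws = ↭-trans (↭-reflexive (sym (absLs-++ (fixed ws) (moved ws)))) (absLs-↭ (fixed-moved-↭ ws))

  cost-split : ∀ {ws : List Word} → cost (fixed ws) ≡ 0 → cost (moved ws) ≡ cost ws
  cost-split {ws} z = begin
    cost (moved ws)                    ≡⟨ cong (_+ cost (moved ws)) z ⟨
    cost (fixed ws) + cost (moved ws)  ≡⟨ cost-++ (fixed ws) (moved ws) ⟨
    cost (fixed ws ++ moved ws)        ≡⟨ cost-↭ (fixed-moved-↭ ws) ⟩
    cost ws ∎
    where open ≡-Reasoning

  module _ (M : List ℕ) (R : List Word) (nks : All (T ∘ isNecklace) R) where

    private
      Y  = image M R
      M′ = Φ₁ M R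
      R′ = Φ₂ M R
      moved-nks : All (T ∘ isNecklace) (moved R)
      moved-nks = All.filter⁺ (∁? Fixed?) nks
      R′↭ : R′ ↭ fixed R ++ map toInc (moved Y)
      R′↭ = Increasing.sort-↭ _
      mvs = moved-toInc (all-moved Y)

    encode-good : All GoodFactor (encode M R)
    encode-good = All.++⁺ (All.map⁺ (All.tabulate (λ {u} _ → GoodFactor-singleton u)))
                          (All.map⁺ (All.map (λ {w} → toDec-good w) moved-nks))

    private
      Y-good : All GoodFactor Y
      Y-good = reflectAll-good encode-good

    Φ₂-necklaces : All (T ∘ isNecklace) R′
    Φ₂-necklaces = Perm.All-resp-↭ (↭-sym R′↭) (All.++⁺ (All.filter⁺ Fixed? nks)
      (All.map⁺ (All.map (λ {w} → toInc-necklace w) (All.filter⁺ (∁? Fixed?) Y-good))))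

    fixed-Φ₂ : fixed R′ ↭ fixed R
    fixed-Φ₂ = ↭-trans (Perm.filter-↭ Fixed? R′↭) (↭-reflexive (fixed-++ (all-fixed R) mvs))

    moved-Φ₂ : moved R′ ↭ map toInc (moved Y)
    moved-Φ₂ = ↭-trans (Perm.filter-↭ (∁? Fixed?) R′↭) (↭-reflexive (moved-++ (all-fixed R) mvs))

    -- `Φ₁` and `Φ₂` store the fixed and the moved factors of `Y` separately, and `encode` reads
    -- back exactly these, discarding the fixed part of `R′`. With `reflectAll-involutive` this
    -- makes the whole map an involution.
    encode-Φ : encode M′ R′ ↭ Y
    encode-Φ = ↭-trans (Perm.++⁺
      (↭-trans (Perm.map⁺ singleton (Numeric.sort-↭ _)) (↭-reflexive (map-singleton-letterOf Y-good)))
      (↭-trans (Perm.map⁺ toDec moved-Φ₂) (↭-reflexive (trans (sym (L.map-∘ (moved Y)))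
        (L.map-id-local (All.map (λ {w} → toDec-toInc w) (All.filter⁺ (∁? Fixed?) Y-good)))))))
      (fixed-moved-↭ Y)

    image-Φ : image M′ R′ ↭ encode M R
    image-Φ = reflectAll-involutive encode-good encode-Φ

    private
      mvs′ : All (∁ Fixed) (map toDec (moved R))
      mvs′ = moved-toDec (all-moved R)

    Φ₁-involutive : Linked _≤_ M → Φ₁ M′ R′ ≡ M
    Φ₁-involutive s = Numeric.sorted-unique (Numeric.sort-↗ _) s (↭-trans (Numeric.sort-↭ _)
      (↭-trans (Perm.map⁺ letterOf (Perm.filter-↭ Fixed? image-Φ))
        (↭-reflexive (trans (cong (map letterOf) (fixed-++ (fixed-map-singleton M) mvs′)) (map-letterOf-singleton M)))))

    Φ₂-involutive : Linked (λ v w → w Inc.≽ v) R → Φ₂ M′ R′ ≡ R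
    Φ₂-involutive s = Increasing.sorted-unique (Increasing.sort-↗ _) (Linked.map flip-≡ s)
      (↭-trans (Increasing.sort-↭ _) (↭-trans (Perm.++⁺ fixed-Φ₂
        (↭-trans (Perm.map⁺ toInc (Perm.filter-↭ (∁? Fixed?) image-Φ)) (↭-reflexive toInc-moved)))
        (fixed-moved-↭ R)))
      where
      flip-≡ : ∀ {v w} → w Inc.≽ v → v Inc.≺ w ⊎ v ≡ w
      flip-≡ (inj₁ p)      = inj₁ p
      flip-≡ (inj₂ refl) = inj₂ refl
      toInc-moved : map toInc (moved (encode M R)) ≡ moved R
      toInc-moved = begin
        map toInc (moved (encode M R))   ≡⟨ cong (map toInc) (moved-++ (fixed-map-singleton M) mvs′) ⟩
        map toInc (map toDec (moved R))  ≡⟨ L.map-∘ (moved R) ⟨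
        map (toInc ∘ toDec) (moved R)    ≡⟨ L.map-id-local (All.map (λ {w} → toInc-toDec w) moved-nks) ⟩
        moved R ∎
        where open ≡-Reasoning

    absLs-encode : absLs (encode M R) ↭ M ++ absLs (moved R)
    absLs-encode = ↭-trans (↭-reflexive (absLs-++ (map singleton M) _))
      (Perm.++⁺ (↭-reflexive (absLs-singleton M)) (absLs-map toDec-↭ (moved R)))

    absLs-Φ : M′ ++ absLs R′ ↭ M ++ absLs R
    absLs-Φ = begin
      M′ ++ absLs R′
        ↭⟨ Perm.++⁺ (Numeric.sort-↭ _) (absLs-↭ R′↭) ⟩
      map letterOf (fixed Y) ++ absLs (fixed R ++ map toInc (moved Y))
        ≡⟨ cong₂ _++_ letters (absLs-++ (fixed R) _) ⟩
      absLs (fixed Y) ++ absLs (fixed R) ++ absLs (map toInc (moved Y))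
        ↭⟨ Perm.shifts (absLs (fixed Y)) (absLs (fixed R)) ⟩
      absLs (fixed R) ++ absLs (fixed Y) ++ absLs (map toInc (moved Y))
        ↭⟨ Perm.++⁺ˡ (absLs (fixed R)) (Perm.++⁺ˡ (absLs (fixed Y)) (absLs-map toInc-↭ (moved Y))) ⟩
      absLs (fixed R) ++ absLs (fixed Y) ++ absLs (moved Y)
        ↭⟨ Perm.++⁺ˡ (absLs (fixed R)) (↭-trans (absLs-split Y) (↭-trans (absLs-reflectAll encode-good) absLs-encode)) ⟩
      absLs (fixed R) ++ M ++ absLs (moved R)
        ↭⟨ Perm.shifts (absLs (fixed R)) M ⟩
      M ++ absLs (fixed R) ++ absLs (moved R)
        ↭⟨ Perm.++⁺ˡ M (absLs-split R) ⟩
      M ++ absLs R ∎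
      where
      open PermutationReasoning
      letters : map letterOf (fixed Y) ≡ absLs (fixed Y)
      letters = trans (sym (absLs-singleton _)) (cong absLs (map-singleton-letterOf Y-good))

    fixedCount-Φ : fixedCount R′ ≡ fixedCount R
    fixedCount-Φ = trans (countB-filter isFixed R′)
      (trans (Perm.↭-length fixed-Φ₂) (sym (countB-filter isFixed R)))

    -- Each discarded necklace has one letter, so the banner has length N = n - j.
    length-encode : length M + length (concat R) ≡ length (concat (encode M R)) + fixedCount R
    length-encode = begin
      length M + length (concat R)
        ≡⟨ cong (λ n → length M + n) (L.length-map absL (concat R)) ⟨
      length M + length (absLs R)
        ≡⟨ cong (λ n → length M + n) (Perm.↭-length (absLs-split R)) ⟨
      length M + length (absLs (fixed R) ++ absLs (moved R))
        ≡⟨ cong (λ n → length M + n) (L.length-++ (absLs (fixed R))) ⟩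
      length M + (length (absLs (fixed R)) + length (absLs (moved R)))
        ≡⟨ solve 3 (λ m f v → m :+ (f :+ v) := (m :+ v) :+ f) refl (length M) (length (absLs (fixed R))) (length (absLs (moved R))) ⟩
      length M + length (absLs (moved R)) + length (absLs (fixed R))
        ≡⟨ cong₂ _+_ (trans (trans (sym (L.length-++ M)) (sym (Perm.↭-length absLs-encode))) (L.length-map absL (concat (encode M R))))
                     (trans (L.length-map absL (concat (fixed R))) (trans (Fixed-length (all-fixed R)) (sym (countB-filter isFixed R)))) ⟩
      length (concat (encode M R)) + fixedCount R ∎
      where
      open ≡-Reasoning
      open +-*-Solver

    cost-encode : cost (encode M R) ≡ cost R
    cost-encode = begin
      cost (encode M R)                                       ≡⟨ cost-++ (map singleton M) _ ⟩
      cost (map singleton M) + cost (map toDec (moved R))     ≡⟨ cong₂ _+_ (cost-singleton M) (cost-map toDec-↭ (moved R)) ⟩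
      cost (moved R)                                          ≡⟨ cost-split {R} (Fixed-cost (All.filter⁺ Fixed? nks) (all-fixed R)) ⟩
      cost R ∎
      where open ≡-Reasoning

    cost-Φ₂ : cost R′ ≡ cost Y
    cost-Φ₂ = begin
      cost R′                                          ≡⟨ cost-↭ R′↭ ⟩
      cost (fixed R ++ map toInc (moved Y))            ≡⟨ cost-++ (fixed R) _ ⟩
      cost (fixed R) + cost (map toInc (moved Y))      ≡⟨ cong₂ _+_ (Fixed-cost (All.filter⁺ Fixed? nks) (all-fixed R)) (cost-map toInc-↭ (moved Y)) ⟩
      cost (moved Y)                                   ≡⟨ cost-split {Y} (trans (cong cost (sym (map-singleton-letterOf Y-good))) (cost-singleton (map letterOf (fixed Y)))) ⟩
      cost Y ∎
      where open ≡-Reasoning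

    cost-Φ : concat (encode M R) ≢ [] → suc (cost R′ + cost R) ≡ length (concat (encode M R)) * l
    cost-Φ ne = trans (cong₂ (λ c d → suc (c + d)) cost-Φ₂ (sym cost-encode)) (cost-reflectAll encode-good ne)

  -- The degree equation and the bijection of coefficient sets

  degree-equation : ∀ l a b j N {n} → n ≡ ℤ.+ (N + j) → ℤ.+ (a + b + 1) ≡ ℤ.+ l ℤ.* (n ℤ.- ℤ.+ j) → a + b + 1 ≡ N * l
  degree-equation l a b j N refl eq = ℤ.+-injective (begin
    ℤ.+ (a + b + 1)            ≡⟨ eq ⟩
    ℤ.+ l ℤ.* (ℤ.+ (N + j) ℤ.- ℤ.+ j)  ≡⟨ cong (ℤ.+ l ℤ.*_) (ℤ.[+m]-[+n]≡m⊖n (N + j) j) ⟩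
    ℤ.+ l ℤ.* ((N + j) ℤ.⊖ j)    ≡⟨ cong (ℤ.+ l ℤ.*_) (ℤ.⊖-≥ (ℕ.m≤n+m j N)) ⟩
    ℤ.+ l ℤ.* ℤ.+ (N + j ∸ j)      ≡⟨ cong (λ m → ℤ.+ l ℤ.* ℤ.+ m) (ℕ.m+n∸n≡m N j) ⟩
    ℤ.+ l ℤ.* ℤ.+ N                ≡⟨ ℤ.pos-* l N ⟨
    ℤ.+ (l * N)              ≡⟨ cong ℤ.+_ (ℕ.*-comm l N) ⟩
    ℤ.+ (N * l) ∎)
    where open ≡-Reasoning

  record Valid (n : ℤ) (c j : ℕ) (α : List ℕ) (M : List ℕ) (R : List Word) : Set where
    field
      sortedM   : Linked _≤_ M
      necklaces : All (T ∘ isNecklace) R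
      sortedR   : Linked (λ v w → w Inc.≽ v) R
      degree    : ℤ.+ (length M + length (concat R)) ≡ n
      cost≡     : cost R ≡ c
      fixed≡    : fixedCount R ≡ j
      weight    : T (hasWeight α (M ++ absLs R))

  open Valid

  fromCond : ∀ n c j α M R → T (hQcond l n c j α M R) → Valid n c j α M R
  fromCond n c j α M R t with T-∧⁻ {sortedBy _≤ᵇ_ M} t
  ... | sM , t₁ with T-∧⁻ {isOrnament R} t₁
  ... | o , t₂ with T-∧⁻ {all isNecklace R} o | T-∧⁻ {⌊ ℤ.+ (length M + length (concat R)) ℤ.≟ n ⌋} t₂
  ... | nk , sR | d , t₃ with T-∧⁻ {cost R ≡ᵇ c} t₃
  ... | c≡ , t₄ with T-∧⁻ {fixedCount R ≡ᵇ j} t₄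
  ... | f≡ , w = record
    { sortedM   = Linked.map (ℕ.≤ᵇ⇒≤ _ _) (sortedBy⇒Linked _≤ᵇ_ M sM)
    ; necklaces = All.all⁺ isNecklace R nk
    ; sortedR   = Linked.map (λ {v} {w} → lexLeq⇒≽ v w) (sortedBy⇒Linked _ R sR)
    ; degree    = toWitness d
    ; cost≡     = ℕ.≡ᵇ⇒≡ _ _ c≡
    ; fixed≡    = ℕ.≡ᵇ⇒≡ _ _ f≡
    ; weight    = w
    }

  toCond : ∀ {n c j α M R} → Valid n c j α M R → T (hQcond l n c j α M R)
  toCond {n} {c} {j} {α} {M} {R} v =
    T-∧⁺ (Linked⇒sortedBy _≤ᵇ_ (Linked.map ℕ.≤⇒≤ᵇ (sortedM v)))
    (T-∧⁺ (T-∧⁺ (All.all⁻ isNecklace (necklaces v))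
                (Linked⇒sortedBy (λ v w → lexLeq (ranks v) (ranks w)) (Linked.map ≽⇒lexLeq (sortedR v))))
    (T-∧⁺ {⌊ ℤ.+ (length M + length (concat R)) ℤ.≟ n ⌋} (fromWitness (degree v))
    (T-∧⁺ (ℕ.≡⇒≡ᵇ _ _ (cost≡ v))
    (T-∧⁺ (ℕ.≡⇒≡ᵇ _ _ (fixed≡ v)) (weight v)))))

  module _ (a b j : ℕ) (n : ℤ) (eq : ℤ.+ (a + b + 1) ≡ ℤ.+ l ℤ.* (n ℤ.- ℤ.+ j)) (α : List ℕ) where

    Φ-Valid : ∀ {M R} → Valid n a j α M R → Valid n b j α (Φ₁ M R) (Φ₂ M R)
    Φ-Valid {M} {R} v = record
      { sortedM   = Numeric.sort-↗ _
      ; necklaces = Φ₂-necklaces M R nks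
      ; sortedR   = Linked.map flip-≡ (Increasing.sort-↗ _)
      ; degree    = trans (cong ℤ.+_ length≡) (degree v)
      ; cost≡     = cost′≡
      ; fixed≡    = trans (fixedCount-Φ M R nks) (fixed≡ v)
      ; weight    = hasWeight-↭ α (↭-sym (absLs-Φ M R nks)) (weight v)
      }
      where
      nks = necklaces v
      flip-≡ : ∀ {v w : Word} → v Inc.≺ w ⊎ v ≡ w → w Inc.≽ v
      flip-≡ (inj₁ p)    = inj₁ p
      flip-≡ (inj₂ refl) = inj₂ refl
      length-absLs : ∀ M R → length (M ++ absLs R) ≡ length M + length (concat R)
      length-absLs M R = trans (L.length-++ M) (cong (λ m → length M + m) (L.length-map absL (concat R)))
      length≡ : length (Φ₁ M R) + length (concat (Φ₂ M R)) ≡ length M + length (concat R)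
      length≡ = trans (sym (length-absLs (Φ₁ M R) (Φ₂ M R)))
                  (trans (Perm.↭-length (absLs-Φ M R nks)) (length-absLs M R))
      N = length (concat (encode M R))
      N-equation : a + b + 1 ≡ N * l
      N-equation = degree-equation l a b j N (trans (sym (degree v)) (cong ℤ.+_
        (trans (length-encode M R nks) (cong (λ m → N + m) (fixed≡ v))))) eq
      -- The cost formula fails for the empty banner, but N = 0 would make a + b + 1 vanish.
      nonempty : concat (encode M R) ≢ []
      nonempty e with trans (trans (ℕ.+-comm 1 (a + b)) N-equation) (cong (λ w → length w * l) e)
      ... | ()
      cost′≡ : cost (Φ₂ M R) ≡ b
      cost′≡ = ℕ.+-cancelʳ-≡ a _ _ (ℕ.suc-injective (begin
        suc (cost (Φ₂ M R) + a)      ≡⟨ cong (λ c → suc (cost (Φ₂ M R) + c)) (cost≡ v) ⟨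
        suc (cost (Φ₂ M R) + cost R) ≡⟨ cost-Φ M R nks nonempty ⟩
        N * l                      ≡⟨ N-equation ⟨
        a + b + 1                    ≡⟨ ℕ.+-comm (a + b) 1 ⟩
        suc (a + b)                  ≡⟨ cong suc (ℕ.+-comm a b) ⟩
        suc (b + a) ∎))
        where open ≡-Reasoning

    Φ : HQcoeffSet l n a j α → HQcoeffSet l n b j α
    Φ (M , R , t) = Φ₁ M R , Φ₂ M R , toCond (Φ-Valid (fromCond n a j α M R t))

  HQcoeffSet-≡ : ∀ n c j α {M M′ R R′} (t : T (hQcond l n c j α M R)) (t′ : T (hQcond l n c j α M′ R′)) →
                 M ≡ M′ → R ≡ R′ → _≡_ {A = HQcoeffSet l n c j α} (M , R , t) (M′ , R′ , t′)
  HQcoeffSet-≡ n c j α t t′ refl refl = cong (λ t → _ , _ , t) (B.T-irrelevant t t′)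

  -- Both directions share `Φ₁` and `Φ₂`; the costs a and b enter only the irrelevant proof
  -- component.
  Φ-involutive : ∀ a b j n eq eq′ α x → Φ b a j n eq′ α (Φ a b j n eq α x) ≡ x
  Φ-involutive a b j n eq eq′ α (M , R , t) =
    HQcoeffSet-≡ n a j α _ t (Φ₁-involutive M R (necklaces v) (sortedM v)) (Φ₂-involutive M R (necklaces v) (sortedR v))
    where v = fromCond n a j α M R t

open import Data.Integer using (ℤ; +_; _*_; _-_)

theorem1p1 : (l a b j : ℕ) (n : ℤ) → 1 ≤ l → 1 ≤ a → 1 ≤ b
    → + (a + b + 1) ≡ + l * (n - + j)
    → (α : List ℕ) → HQcoeffSet l n a j α ↔ HQcoeffSet l n b j α
theorem1p1 (suc k) a b j n _ _ _ eq α =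
  mk↔ₛ′ (Φ a b j n eq α) (Φ b a j n eq′ α) (Φ-involutive b a j n eq′ eq α) (Φ-involutive a b j n eq eq′ α)
  where
  eq′ : + (b + a + 1) ≡ + suc k * (n - + j)
  eq′ = trans (cong (λ m → + (m + 1)) (ℕ.+-comm b a)) eq
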